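{- A cirquent is valid if and only if it is provable in $RIF_p$.
   Context: Formulas. There are infinitely many atoms. A literal is an atom $p$ or its negation $\neg p$. A formula is built from literals by the binary connectives $\wedge,\vee$ (negation normal form). Cirquents. A cirquent is a formula together with a clustering and a ranking. A clustering is a partition of the set of all occurrences of $\vee,\wedge$ into subsets called clusters, all occurrences in one cluster being of the same type. A ranking is a partition of the set of all clusters into subsets called ranks, arranged in a linear order, all clusters in one rank being of the same type; a rank is conjunctive if it contains $\wedge$-clusters and disjunctive if it contains $\vee$-clusters. Each cluster has a unique positive integer called its ID; "cluster $k$" is the cluster with ID $k$. Ranks are referred to by number according to their order (rank $1$, rank $2$, ...). A cirquent is written as its formula with each connective occurrence carrying an index $k^{i}$, meaning that this occurrence belongs to cluster $k$ and that cluster $k$ is of rank $i$. An "oconnective" is a connective together with a particular occurrence of it in a cirquent. A cluster is a singleton (in a given cirquent) if it contains exactly one occurrence in that whole cirquent. A cirquent is classical iff all of its clusters are singletons; such a cirquent is identified with the classical propositional formula obtained by deleting all indices. Semantics. An interpretation $^{\ast}$ sends each atom to $\top$ or $\bot$, extended by $(\neg p)^{\ast}=\top$ iff $p^{\ast}=\bot$. An $i$-metaselection is a function $f_i:\{1,2,3,\ldots\}\to\{\mathit{left},\mathit{right}\}$; a metaselection for a cirquent with $n$ ranks is a tuple $(f_1,\ldots,f_n)$ with each $f_i$ an $i$-metaselection. The resolvent of $\mathcal{A}\vee_{k^{i}}\mathcal{B}$ or $\mathcal{A}\wedge_{k^{i}}\mathcal{B}$ is $\mathcal{A}$ if $f_i(k)=\mathit{left}$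 and $\mathcal{B}$ if $f_i(k)=\mathit{right}$. A literal $L$ is metatrue w.r.t. $(^{\ast},(f_1,\ldots,f_n))$ iff $L^{\ast}=\top$; a subcirquent $\mathcal{A}\vee_{k^{i}}\mathcal{B}$ or $\mathcal{A}\wedge_{k^{i}}\mathcal{B}$ is metatrue iff its resolvent is. A cirquent $\mathcal{C}$ with $n$ ranks is true under $^{\ast}$ iff $\mathcal{Q}_1f_1\ldots\mathcal{Q}_nf_n$ such that $\mathcal{C}$ is metatrue w.r.t. $(^{\ast},(f_1,\ldots,f_n))$, where $\mathcal{Q}_if_i$ means "for every $i$-metaselection $f_i$" if the $i$th rank of $\mathcal{C}$ is conjunctive and "there is an $i$-metaselection $f_i$" if it is disjunctive. A cirquent is valid iff it is true under every interpretation. Notation for rules. $\Phi\{\}$, $\Psi\{\}$ denote cirquents with a vacancy (hole) in the place of one subcirquent; $\Phi\{\mathcal{X}\}$ is the result of filling the hole with $\mathcal{X}$. $\mathcal{C}[k^i]$ denotes a cirquent $\mathcal{C}$ containing some occurrence of the index $k^i$, and $\mathcal{C}[k^i/l^i]$ is the result of replacing all occurrences of $k^i$ in it by $l^i$. $\mathcal{A},\mathcal{B},\mathcal{C},\mathcal{D}$ are any cirquents, and $\odot,\circ\in\{\wedge,\vee\}$; within one rule all occurrences of $\odot$ (resp. $\circ$) are the same connective. Premise and conclusion are both cirquents. The premise keeps the rank numbers of the conclusion, so ranks have the same relative order in both; in Rule I some ranks of the conclusion may be absent from the premise, the quantifier prefix in the definition of truth of the premise then being over the remaining ranks in their order. Inference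 rules of $RIF_p$. Rule I (left): from $\Phi\{\Psi\{\mathcal{A}\}\odot_{k^i}\mathcal{C}\}$ infer $\Phi\{\Psi\{\mathcal{A}\odot_{k^i}\mathcal{B}\}\odot_{k^i}\mathcal{C}\}$. Rule I (right): from $\Phi\{\mathcal{C}\odot_{k^i}\Psi\{\mathcal{A}\}\}$ infer $\Phi\{\mathcal{C}\odot_{k^i}\Psi\{\mathcal{B}\odot_{k^i}\mathcal{A}\}\}$. Rule II (left): from $\Phi\{(\mathcal{A}\circ_{m^j}\mathcal{C}_1)\odot_{k^i}(\mathcal{B}\circ_{n^j}\mathcal{C}_2)\}$ infer $\Phi\{(\mathcal{A}\odot_{k^i}\mathcal{B})\circ_{l^j}\mathcal{C}\}$. Rule II (right): from $\Phi\{(\mathcal{C}_1\circ_{m^j}\mathcal{A})\odot_{k^i}(\mathcal{C}_2\circ_{n^j}\mathcal{B})\}$ infer $\Phi\{\mathcal{C}\circ_{l^j}(\mathcal{A}\odot_{k^i}\mathcal{B})\}$. Conditions for both versions of Rule II: (i) if cluster $l$ is a non-singleton in the conclusion then $m=n=l$, and if cluster $l$ is a singleton in the conclusion then $m,n$ are any positive integers such that clusters $m,n$ are singletons in the premise; (ii) $i\le j$; (iii) every rank $t$ occurring in $\mathcal{C}$ (in the conclusion) satisfies $t\ge i$; (iv) $\mathcal{C}_1$ (resp. $\mathcal{C}_2$) results from $\mathcal{C}$ by replacing in $\mathcal{C}$ each singleton cluster $s$ (singleton in the conclusion) of whatever rank $r$ by a cluster $s_1$ (resp. $s_2$) of the same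 rank $r$ that is a singleton in the premise. Rule III: from $\Phi\{(\mathcal{A}\circ_{m^j}\mathcal{C})\odot_{k^i}(\mathcal{B}\circ_{n^j}\mathcal{D})\}$ infer $\Phi\{(\mathcal{A}\odot_{k^i}\mathcal{B})\circ_{l^j}(\mathcal{C}\odot_{k^i}\mathcal{D})\}$. Conditions: (i) if cluster $l$ is a non-singleton in the conclusion then $m=n=l$, and if cluster $l$ is a singleton in the conclusion then $m,n$ are any positive integers such that clusters $m,n$ are singletons in the premise; (ii) $i\le j$. Rule IV: from $\Phi\{\mathcal{A}[l^j]\odot_{k^i}\mathcal{B}[l^j/r^j]\}$ infer $\Phi\{\mathcal{A}[l^j]\odot_{k^i}\mathcal{B}[l^j]\}$. Conditions: (i) in the conclusion $l$ occurs only in the subcirquents $\mathcal{A}$ and $\mathcal{B}$, and $r$ (in the premise) is any positive integer not occurring (as a cluster ID) in the conclusion; (ii) $i<j$. Axioms of $RIF_p$: all classical cirquents that, seen as formulas, are tautologies of classical propositional logic. Provability. A proof of a cirquent $\mathcal{C}$ in $RIF_p$ is a (finite) sequence of cirquents whose first member is an axiom of $RIF_p$, whose last member is $\mathcal{C}$, and in which every cirquent except the first follows from the immediately preceding one by one of the rules above. $\mathcal{C}$ is provable in $RIF_p$ iff such a proof exists. -}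

module Defs where

open import Data.Bool using (Bool; true; false; not; if_then_else_)
import Data.Bool as Bool
open import Data.List using (List; []; _∷_; _++_; length; filter; map; foldr; head; upTo)
open import Data.List.Membership.Propositional using (_∈_)
open import Data.List.Relation.Unary.All using (All)
open import Data.List.Relation.Unary.Any using (Any)
open import Data.Maybe using (Maybe; just; nothing)
import Data.Maybe as Maybe
open import Data.Nat using (ℕ; suc; _+_; _⊔_; _≤_; _<_; _≟_)
open import Data.Product using (Σ; ∃-syntax; _×_)
open import Relation.Binary.Construct.Closure.ReflexiveTransitive using (Star)
open import Relation.Binary.PropositionalEquality using (_≡_)
open import Relation.Nullary using (¬_; does)

Atom : Set
Atom = ℕ

data Literal : Set where
  pos neg : Atom → Literal

data Conn : Set where
  ∧ ∨ : Conn

data Formula : Set where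
  lit    : Literal → Formula
  _⟨_⟩ᶠ_ : Formula → Conn → Formula → Formula

Interpretation : Set
Interpretation = Atom → Bool

⟦_⟧ˡ : Literal → Interpretation → Bool
⟦ pos p ⟧ˡ I = I p
⟦ neg p ⟧ˡ I = not (I p)

⟦_⟧ᶠ : Formula → Interpretation → Bool
⟦ lit L ⟧ᶠ      I = ⟦ L ⟧ˡ I
⟦ A ⟨ ∧ ⟩ᶠ B ⟧ᶠ I = ⟦ A ⟧ᶠ I Bool.∧ ⟦ B ⟧ᶠ I
⟦ A ⟨ ∨ ⟩ᶠ B ⟧ᶠ I = ⟦ A ⟧ᶠ I Bool.∨ ⟦ B ⟧ᶠ I

Tautology : Formula → Set
Tautology A = ∀ I → ⟦ A ⟧ᶠ I ≡ true

-- The positive integer n + 1 is represented by n.  Of cluster IDs only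
-- equality matters, and of rank numbers only equality and order.
ID Rank : Set
ID   = ℕ
Rank = ℕ

-- c [ k ^ i ] is an occurrence of c belonging to cluster k, of rank i.
record Oconnective : Set where
  constructor _[_^_]
  field
    conn : Conn
    id   : ID
    rank : Rank

open Oconnective public

infix 7 _⟨_⟩_

-- Formulas all of whose connective occurrences carry an index.
data Tree : Set where
  lit   : Literal → Tree
  _⟨_⟩_ : Tree → Oconnective → Tree → Tree

oconnectives : Tree → List Oconnective
oconnectives (lit _)     = []
oconnectives (A ⟨ o ⟩ B) = oconnectives A ++ o ∷ oconnectives B

erase : Tree → Formula
erase (lit L)     = lit L
erase (A ⟨ o ⟩ B) = erase A ⟨ conn o ⟩ᶠ erase B

-- The indices in T come from a clustering and a ranking: the fibres of id
-- are clusters of uniform type, each lying within a single rank, and the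
-- fibres of rank are of uniform type.
record Coherent (T : Tree) : Set where
  field
    cluster-conn : ∀ {o o′} → o ∈ oconnectives T → o′ ∈ oconnectives T →
                   id o ≡ id o′ → conn o ≡ conn o′
    cluster-rank : ∀ {o o′} → o ∈ oconnectives T → o′ ∈ oconnectives T →
                   id o ≡ id o′ → rank o ≡ rank o′
    rank-conn    : ∀ {o o′} → o ∈ oconnectives T → o′ ∈ oconnectives T →
                   rank o ≡ rank o′ → conn o ≡ conn o′

-- The rank numbers in use need not be consecutive: an inference may remove
-- all occurrences of a rank without renumbering the others.
record Cirquent : Set where
  field
    tree     : Tree
    coherent : Coherent tree

open Cirquent public

count : ID → Tree → ℕ
count k T = length (filter (λ o → id o ≟ k) (oconnectives T))

Occurs : ID → Tree → Set
Occurs k T = Any (λ o → id o ≡ k) (oconnectives T)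

OccursIndex : ID → Rank → Tree → Set
OccursIndex k i T = Any (λ o → id o ≡ k × rank o ≡ i) (oconnectives T)

Singleton : ID → Tree → Set
Singleton k T = count k T ≡ 1

Classical : Tree → Set
Classical T = ∀ k → Occurs k T → Singleton k T

data Side : Set where
  left right : Side

-- F i is the metaselection for rank i.
Metaselection : Set
Metaselection = Rank → ID → Side

_[_≔_] : Metaselection → Rank → (ID → Side) → Metaselection
(F [ i ≔ f ]) j = if does (j ≟ i) then f else F j

select : Side → Tree → Tree → Tree
select left  A B = A
select right A B = B

resolvent : Metaselection → Tree → Oconnective → Tree → Tree
resolvent F A o B = select (F (rank o) (id o)) A B

data Metatrue (I : Interpretation) (F : Metaselection) : Tree → Set where
  lit  : ∀ {L} → ⟦ L ⟧ˡ I ≡ true → Metatrue I F (lit L)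
  node : ∀ {A o B} → Metatrue I F (resolvent F A o B) → Metatrue I F (A ⟨ o ⟩ B)

-- The type of rank i of T, or nothing if no cluster of T has rank i.
rankConn : Tree → Rank → Maybe Conn
rankConn T i = Maybe.map conn (head (filter (λ o → rank o ≟ i) (oconnectives T)))

quantify : Maybe Conn → Rank → (Metaselection → Set) → (Metaselection → Set)
quantify (just ∧) i P F = (f : ID → Side) → P (F [ i ≔ f ])
quantify (just ∨) i P F = ∃[ f ] P (F [ i ≔ f ])
quantify nothing  i P F = P F

rankBound : Tree → ℕ
rankBound T = suc (foldr _⊔_ 0 (map rank (oconnectives T)))

-- The quantifier prefix ranges, in increasing order, over the ranks of T.
-- The initial metaselection is immaterial, since its value at every rank
-- of T is overwritten by the prefix.
TrueUnder : Interpretation → Tree → Set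
TrueUnder I T =
  foldr (λ i → quantify (rankConn T i) i) (λ F → Metatrue I F T)
        (upTo (rankBound T)) (λ _ _ → left)

Valid : Cirquent → Set
Valid C = ∀ I → TrueUnder I (tree C)

data Context : Set where
  hole    : Context
  leftOf  : Context → Oconnective → Tree → Context
  rightOf : Tree → Oconnective → Context → Context

infix 8 _⟦_⟧

_⟦_⟧ : Context → Tree → Tree
hole          ⟦ X ⟧ = X
leftOf Φ o B  ⟦ X ⟧ = (Φ ⟦ X ⟧) ⟨ o ⟩ B
rightOf A o Φ ⟦ X ⟧ = A ⟨ o ⟩ (Φ ⟦ X ⟧)

-- T ⟪ k ^ i ↦ l ⟫ is T with all occurrences of the index kⁱ replaced by lⁱ.
_⟪_^_↦_⟫ : Tree → ID → Rank → ID → Tree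
lit L                   ⟪ k ^ i ↦ l ⟫ = lit L
(A ⟨ c [ k′ ^ i′ ] ⟩ B) ⟪ k ^ i ↦ l ⟫ =
  (A ⟪ k ^ i ↦ l ⟫) ⟨ c [ k″ ^ i′ ] ⟩ (B ⟪ k ^ i ↦ l ⟫)
  where k″ = if does (k′ ≟ k) Bool.∧ does (i′ ≟ i) then l else k′

-- Here and in Refreshed, P is the premise of an inference and Q its conclusion.
Splits : (P Q : Tree) (l m n : ID) → Set
Splits P Q l m n =
  (¬ Singleton l Q → m ≡ l × n ≡ l) ×
  (Singleton l Q → Singleton m P × Singleton n P)

-- Refreshed P Q C C′: C′ results from C by replacing each cluster that is a
-- singleton in Q by a cluster of the same rank that is a singleton in P.
data Refreshed (P Q : Tree) : Tree → Tree → Set where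
  lit     : ∀ {L} → Refreshed P Q (lit L) (lit L)
  replace : ∀ {A A′ B B′ c s s′ r} → Singleton s Q → Singleton s′ P →
            Refreshed P Q A A′ → Refreshed P Q B B′ →
            Refreshed P Q (A ⟨ c [ s ^ r ] ⟩ B) (A′ ⟨ c [ s′ ^ r ] ⟩ B′)
  keep    : ∀ {A A′ B B′ c s r} → ¬ Singleton s Q →
            Refreshed P Q A A′ → Refreshed P Q B B′ →
            Refreshed P Q (A ⟨ c [ s ^ r ] ⟩ B) (A′ ⟨ c [ s ^ r ] ⟩ B′)

infix 4 _⟶_ _⊢_

-- P ⟶ Q: the conclusion Q follows from the premise P by one of the rules.
data _⟶_ : Tree → Tree → Set where

  I-left : ∀ Φ Ψ {⊙ k i A B C} →
    Φ ⟦ (Ψ ⟦ A ⟧) ⟨ ⊙ [ k ^ i ] ⟩ C ⟧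
      ⟶
    Φ ⟦ (Ψ ⟦ A ⟨ ⊙ [ k ^ i ] ⟩ B ⟧) ⟨ ⊙ [ k ^ i ] ⟩ C ⟧

  I-right : ∀ Φ Ψ {⊙ k i A B C} →
    Φ ⟦ C ⟨ ⊙ [ k ^ i ] ⟩ (Ψ ⟦ A ⟧) ⟧
      ⟶
    Φ ⟦ C ⟨ ⊙ [ k ^ i ] ⟩ (Ψ ⟦ B ⟨ ⊙ [ k ^ i ] ⟩ A ⟧) ⟧

  II-left : ∀ Φ {⊙ ∘ k i l m n j A B C C₁ C₂} →
    let P = Φ ⟦ (A ⟨ ∘ [ m ^ j ] ⟩ C₁) ⟨ ⊙ [ k ^ i ] ⟩ (B ⟨ ∘ [ n ^ j ] ⟩ C₂) ⟧
        Q = Φ ⟦ (A ⟨ ⊙ [ k ^ i ] ⟩ B) ⟨ ∘ [ l ^ j ] ⟩ C ⟧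
    in
    Splits P Q l m n →
    i ≤ j →
    All (λ o → i ≤ rank o) (oconnectives C) →
    Refreshed P Q C C₁ →
    Refreshed P Q C C₂ →
    P ⟶ Q

  II-right : ∀ Φ {⊙ ∘ k i l m n j A B C C₁ C₂} →
    let P = Φ ⟦ (C₁ ⟨ ∘ [ m ^ j ] ⟩ A) ⟨ ⊙ [ k ^ i ] ⟩ (C₂ ⟨ ∘ [ n ^ j ] ⟩ B) ⟧
        Q = Φ ⟦ C ⟨ ∘ [ l ^ j ] ⟩ (A ⟨ ⊙ [ k ^ i ] ⟩ B) ⟧
    in
    Splits P Q l m n →
    i ≤ j →
    All (λ o → i ≤ rank o) (oconnectives C) →
    Refreshed P Q C C₁ →
    Refreshed P Q C C₂ →
    P ⟶ Q

  III : ∀ Φ {⊙ ∘ k i l m n j A B C D} →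
    let P = Φ ⟦ (A ⟨ ∘ [ m ^ j ] ⟩ C) ⟨ ⊙ [ k ^ i ] ⟩ (B ⟨ ∘ [ n ^ j ] ⟩ D) ⟧
        Q = Φ ⟦ (A ⟨ ⊙ [ k ^ i ] ⟩ B) ⟨ ∘ [ l ^ j ] ⟩ (C ⟨ ⊙ [ k ^ i ] ⟩ D) ⟧
    in
    Splits P Q l m n →
    i ≤ j →
    P ⟶ Q

  -- The equation between counts says that all occurrences of l in the
  -- conclusion are in the displayed subcirquents A and B.
  IV : ∀ Φ {⊙ k i l r j A B} →
    let P = Φ ⟦ A ⟨ ⊙ [ k ^ i ] ⟩ (B ⟪ l ^ j ↦ r ⟫) ⟧
        Q = Φ ⟦ A ⟨ ⊙ [ k ^ i ] ⟩ B ⟧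
    in
    OccursIndex l j A →
    OccursIndex l j B →
    count l Q ≡ count l A + count l B →
    ¬ Occurs r Q →
    i < j →
    P ⟶ Q

_⊢_ : Cirquent → Cirquent → Set
P ⊢ Q = tree P ⟶ tree Q

Axiom : Cirquent → Set
Axiom C = Classical (tree C) × Tautology (erase (tree C))

Provable : Cirquent → Set
Provable C = Σ Cirquent λ A → Axiom A × Star _⊢_ A C

{-# OPTIONS --safe #-}
module Submission where

-- Soundness and completeness both rest on the fact that every rule preserves
-- truth in both directions.  Rules II, III and IV first copy clusters into the
-- two branches of an occurrence of kⁱ and then give the copies separate names
-- in each branch; since only ranks ≥ i are renamed, a player knows the
-- selection made at k when a renamed cluster is due, so metaselections can be
-- translated back and forth.
--
-- For completeness, Rule II, read upwards, pushes low ranks outwards until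
-- ranks never decrease from the root downwards.  A non-singleton cluster of
-- rank i is then dissolved as follows: Rule IV gives it a separate name in each
-- maximal subtree whose ranks are all ≥ i, where Rules II and III bring it to
-- the root and Rule I erases its repetitions.  No rule used creates a new
-- non-singleton cluster that survives, so treating all clusters in turn
-- produces a classical cirquent, which is valid exactly when it is a tautology.

open import Defs
open import Data.Bool using (Bool; true; false; if_then_else_)
import Data.Bool as Bool
open import Data.Empty using (⊥-elim)
open import Data.List using (List; []; _∷_; _++_; length; filter; map; foldr; head; applyUpTo)
open import Data.List.Membership.Propositional using (_∈_; find; lose)
open import Data.List.Membership.Propositional.Properties using (∈-++⁺ˡ; ∈-++⁺ʳ; ∈-filter⁺; ∈-map⁺)
open import Data.List.Properties using (filter-++; length-++; filter-accept; filter-reject)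
open import Data.List.Relation.Unary.All as All using (All; []; _∷_)
open import Data.List.Relation.Unary.All.Properties using (++⁺; ++⁻ˡ; ++⁻ʳ; ¬Any⇒All¬; All¬⇒¬Any)
open import Data.List.Relation.Unary.Any as Any using (Any; here; there)
open import Data.Maybe using (Maybe; just; nothing; fromMaybe)
import Data.Maybe as Maybe
open import Data.Nat using (ℕ; zero; suc; _+_; _∸_; _⊔_; _≤_; _<_; _≟_; _≤?_; _<?_; z≤n; s≤s)
open import Data.Nat.Properties
open import Data.Nat.Tactic.RingSolver using (solve-∀)
open import Data.Product using (Σ; ∃-syntax; _×_; _,_; proj₁; proj₂)
open import Data.Sum using (_⊎_; inj₁; inj₂)
open import Function using (_∘_; case_of_)
open import Function.Bundles using (_⇔_; mk⇔)
open import Relation.Binary.Construct.Closure.ReflexiveTransitive using (Star; ε; _◅_; _◅◅_)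
open import Relation.Binary.PropositionalEquality
open import Relation.Nullary using (¬_; Dec; yes; no; does)
open import Relation.Nullary.Decidable using (dec-true; dec-false)

-- Two obstacles shape the proof. A premise may lack ranks of its conclusion, so the two quantifier
-- prefixes differ; both cirquents are therefore judged under one prefix that runs through all ranks
-- below a common bound. A win is then carried from one to the other quantifier by quantifier, and
-- strategies never appear as objects. The second obstacle is that being a singleton is a property
-- of the whole cirquent, while a rule acts on a subtree, and Rule II read upwards even duplicates a
-- subtree. So every transformation of a subtree is indexed by the full premise and conclusion. It
-- records that a cluster which is a non-singleton above was already one below; the list of such IDs
-- then measures progress although the trees may grow, and the coherence of intermediate trees
-- follows from the same record. For the final classical cirquent the order of ranks stops
-- mattering, because each player has an optimal selection that depends on the interpretation alone
-- and not on the other player's moves.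

-- Predicates on oconnectives and counting of occurrences

data Every (p : Oconnective → Set) : Tree → Set where
  lit  : ∀ {L} → Every p (lit L)
  node : ∀ {A o B} → Every p A → p o → Every p B → Every p (A ⟨ o ⟩ B)

Every-map : ∀ {p q T} → (∀ {o} → p o → q o) → Every p T → Every q T
Every-map f lit          = lit
Every-map f (node a x b) = node (Every-map f a) (f x) (Every-map f b)

Every-zip : ∀ {p q T} → Every p T → Every q T → Every (λ o → p o × q o) T
Every-zip lit          lit            = lit
Every-zip (node a x b) (node a′ y b′) = node (Every-zip a a′) (x , y) (Every-zip b b′)

Every-plug : ∀ {p q T T′} Φ → (Every p T → Every q T′) → (∀ {o} → p o → q o) →
             Every p (Φ ⟦ T ⟧) → Every q (Φ ⟦ T′ ⟧)
Every-plug hole            f g t            = f t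
Every-plug (leftOf Φ o B)  f g (node a x b) = node (Every-plug Φ f g a) (g x) (Every-map g b)
Every-plug (rightOf A o Φ) f g (node a x b) = node (Every-map g a) (g x) (Every-plug Φ f g b)

Every⇒All : ∀ {p T} → Every p T → All p (oconnectives T)
Every⇒All lit          = []
Every⇒All (node a x b) = ++⁺ (Every⇒All a) (x ∷ Every⇒All b)

All⇒Every : ∀ {p} T → All p (oconnectives T) → Every p T
All⇒Every (lit L)     xs = lit
All⇒Every (A ⟨ o ⟩ B) xs with ++⁻ʳ (oconnectives A) xs
... | x ∷ ys = node (All⇒Every A (++⁻ˡ (oconnectives A) xs)) x (All⇒Every B ys)

Every-lookup : ∀ {p T o} → Every p T → o ∈ oconnectives T → p o
Every-lookup e = All.lookup (Every⇒All e)

Every-∈ : ∀ T → Every (λ o → o ∈ oconnectives T) T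
Every-∈ T = All⇒Every T (All.tabulate λ x∈ → x∈)

Every-tabulate : ∀ {p} T → (∀ {o} → o ∈ oconnectives T → p o) → Every p T
Every-tabulate T f = All⇒Every T (All.tabulate f)

δ : ID → ID → ℕ
δ x y = if does (y ≟ x) then 1 else 0

δ-≡ : ∀ {x y} → y ≡ x → δ x y ≡ 1
δ-≡ {x} {y} e rewrite dec-true (y ≟ x) e = refl

δ-≢ : ∀ {x y} → y ≢ x → δ x y ≡ 0
δ-≢ {x} {y} e rewrite dec-false (y ≟ x) e = refl

-- Structural recursion in place of filtering a list: the counts in an instance of a rule become
-- sums, and comparing premise with conclusion becomes an identity for the ring solver.
cnt : ID → Tree → ℕ
cnt x (lit L)     = 0
cnt x (A ⟨ o ⟩ B) = cnt x A + (δ x (id o) + cnt x B)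

cntᶜ : ID → Context → ℕ
cntᶜ x hole            = 0
cntᶜ x (leftOf Φ o B)  = cntᶜ x Φ + (δ x (id o) + cnt x B)
cntᶜ x (rightOf A o Φ) = cnt x A + (δ x (id o) + cntᶜ x Φ)

cnt-plug : ∀ x Φ T → cnt x (Φ ⟦ T ⟧) ≡ cntᶜ x Φ + cnt x T
cnt-plug x hole            T = refl
cnt-plug x (leftOf Φ o B)  T = begin
  cnt x (Φ ⟦ T ⟧) + r        ≡⟨ cong (_+ r) (cnt-plug x Φ T) ⟩
  (cntᶜ x Φ + cnt x T) + r   ≡⟨ +-assoc (cntᶜ x Φ) (cnt x T) r ⟩
  cntᶜ x Φ + (cnt x T + r)   ≡⟨ cong (cntᶜ x Φ +_) (+-comm (cnt x T) r) ⟩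
  cntᶜ x Φ + (r + cnt x T)   ≡⟨ +-assoc (cntᶜ x Φ) r (cnt x T) ⟨
  (cntᶜ x Φ + r) + cnt x T   ∎
  where
  open ≡-Reasoning
  r = δ x (id o) + cnt x B
cnt-plug x (rightOf A o Φ) T = begin
  cnt x A + (δ x (id o) + cnt x (Φ ⟦ T ⟧))
    ≡⟨ cong (λ n → cnt x A + (δ x (id o) + n)) (cnt-plug x Φ T) ⟩
  cnt x A + (δ x (id o) + (cntᶜ x Φ + cnt x T))
    ≡⟨ cong (cnt x A +_) (+-assoc (δ x (id o)) (cntᶜ x Φ) (cnt x T)) ⟨
  cnt x A + ((δ x (id o) + cntᶜ x Φ) + cnt x T)
    ≡⟨ +-assoc (cnt x A) (δ x (id o) + cntᶜ x Φ) (cnt x T) ⟨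
  cntᶜ x (rightOf A o Φ) + cnt x T ∎
  where open ≡-Reasoning

count≡cnt : ∀ x T → count x T ≡ cnt x T
count≡cnt x (lit L)     = refl
count≡cnt x (A ⟨ o ⟩ B) = begin
  length (filter P? (oconnectives A ++ o ∷ oconnectives B))
    ≡⟨ cong length (filter-++ P? (oconnectives A) (o ∷ oconnectives B)) ⟩
  length (filter P? (oconnectives A) ++ filter P? (o ∷ oconnectives B))
    ≡⟨ length-++ (filter P? (oconnectives A)) ⟩
  count x A + length (filter P? (o ∷ oconnectives B))
    ≡⟨ cong₂ _+_ (count≡cnt x A) (step (id o ≟ x)) ⟩
  cnt x A + (δ x (id o) + cnt x B) ∎
  where
  open ≡-Reasoning
  P? = λ o → id o ≟ x
  step : Dec (id o ≡ x) →
         length (filter P? (o ∷ oconnectives B)) ≡ δ x (id o) + cnt x B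
  step (yes e) = trans (cong length (filter-accept P? e))
                       (trans (cong suc (count≡cnt x B)) (cong (_+ cnt x B) (sym (δ-≡ e))))
  step (no e)  = trans (cong length (filter-reject P? e))
                       (trans (count≡cnt x B) (cong (_+ cnt x B) (sym (δ-≢ e))))

cnt-left : ∀ {x A o B} → cnt x A ≤ cnt x (A ⟨ o ⟩ B)
cnt-left = m≤m+n _ _

cnt-right : ∀ {x A o B} → cnt x B ≤ cnt x (A ⟨ o ⟩ B)
cnt-right {x} {A} {o} {B} = ≤-trans (m≤n+m (cnt x B) (δ x (id o))) (m≤n+m _ (cnt x A))

cnt-root : ∀ {A o B} → 1 ≤ cnt (id o) (A ⟨ o ⟩ B)
cnt-root {A} {o} {B} =
  ≤-trans (≤-reflexive (sym (δ-≡ {id o} refl)))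
    (≤-trans (m≤m+n _ (cnt (id o) B)) (m≤n+m _ (cnt (id o) A)))

Every-occurs : ∀ T → Every (λ o → 1 ≤ cnt (id o) T) T
Every-occurs (lit L)     = lit
Every-occurs (A ⟨ o ⟩ B) =
  node (Every-map (λ {o′} l → ≤-trans l (cnt-left {id o′} {A} {o} {B})) (Every-occurs A))
       (cnt-root {A} {o} {B})
       (Every-map (λ {o′} l → ≤-trans l (cnt-right {id o′} {A} {o} {B})) (Every-occurs B))

Absent : ID → Tree → Set
Absent x = Every (λ o → id o ≢ x)

cnt-absent : ∀ {x T} → Absent x T → cnt x T ≡ 0
cnt-absent lit          = refl
cnt-absent (node a e b) = cong₂ _+_ (cnt-absent a) (cong₂ _+_ (δ-≢ e) (cnt-absent b))

absent-cnt : ∀ {x} T → cnt x T ≡ 0 → Absent x T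
absent-cnt {x} T z =
  Every-map (λ {o} l e → <-irrefl (sym (trans (cong (λ y → cnt y T) e) z)) l) (Every-occurs T)

absent? : ∀ x T → Absent x T ⊎ 1 ≤ cnt x T
absent? x T with cnt x T in e
... | zero  = inj₁ (absent-cnt T e)
... | suc n = inj₂ (s≤s z≤n)

-- Metatruth as a Boolean value, truth as a game

pick : Side → Bool → Bool → Bool
pick left  a b = a
pick right a b = b

-- As a Boolean function, metatruth can be compared between two trees by equations and congruence,
-- and the types of connectives visibly have no influence on it.
eval : Interpretation → Metaselection → Tree → Bool
eval I F (lit L)     = ⟦ L ⟧ˡ I
eval I F (A ⟨ o ⟩ B) = pick (F (rank o) (id o)) (eval I F A) (eval I F B)

Metatrue⇒eval : ∀ {I F T} → Metatrue I F T → eval I F T ≡ true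
Metatrue⇒eval (lit e) = e
Metatrue⇒eval {I} {F} (node {A} {o} {B} m) =
  trans (sym (eval-select (F (rank o) (id o)))) (Metatrue⇒eval m)
  where
  eval-select : ∀ s → eval I F (select s A B) ≡ pick s (eval I F A) (eval I F B)
  eval-select left  = refl
  eval-select right = refl

eval⇒Metatrue : ∀ {I F} T → eval I F T ≡ true → Metatrue I F T
eval⇒Metatrue (lit L) e = lit e
eval⇒Metatrue {I} {F} (A ⟨ o ⟩ B) e = node (go (F (rank o) (id o)) e)
  where
  go : ∀ s → pick s (eval I F A) (eval I F B) ≡ true → Metatrue I F (select s A B)
  go left  = eval⇒Metatrue A
  go right = eval⇒Metatrue B

eval-plug : ∀ {I F T T′} Φ → eval I F T ≡ eval I F T′ → eval I F (Φ ⟦ T ⟧) ≡ eval I F (Φ ⟦ T′ ⟧)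
eval-plug hole            e = e
eval-plug {I} {F} (leftOf Φ o B)  e = cong (λ b → pick (F (rank o) (id o)) b (eval I F B)) (eval-plug Φ e)
eval-plug {I} {F} (rightOf A o Φ) e = cong (pick (F (rank o) (id o)) (eval I F A)) (eval-plug Φ e)

update-same : ∀ F r f → (F [ r ≔ f ]) r ≡ f
update-same F r f rewrite dec-true (r ≟ r) refl = refl

update-other : ∀ F {r s} f → s ≢ r → (F [ r ≔ f ]) s ≡ F s
update-other F {r} {s} f e rewrite dec-false (s ≟ r) e = refl

-- Ranks n, n + 1, …, n + m - 1 are quantified, in this order.
Game : (Rank → Maybe Conn) → (Metaselection → Set) → ℕ → ℕ → Metaselection → Set
Game q P n zero    = P
Game q P n (suc m) = quantify (q n) n (Game q P (suc n) m)

-- The rest of either game is an arbitrary predicate. It suffices to transfer a single quantifier,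
-- assuming that the rest can be transferred from any pair of related metaselections; iterating this
-- transfers a winning strategy one rank at a time.
Simulation : (q q′ : Rank → Maybe Conn) → (ℕ → Metaselection → Metaselection → Set) → Set₁
Simulation q q′ R = ∀ n {F F′} {S S′ : Metaselection → Set} → R n F F′ →
  (∀ {G G′} → R (suc n) G G′ → S G → S′ G′) →
  quantify (q n) n S F → quantify (q′ n) n S′ F′

Game-simulate : ∀ {q q′ R P P′} → Simulation q q′ R → ∀ n m {F F′} → R n F F′ →
  (∀ {G G′} → R (n + m) G G′ → P G → P′ G′) → Game q P n m F → Game q′ P′ n m F′
Game-simulate {R = R} sim n zero    r fin g =
  fin (subst (λ k → R k _ _) (sym (+-identityʳ n)) r) g
Game-simulate {R = R} sim n (suc m) r fin g =
  sim n r (λ r′ → Game-simulate sim (suc n) m r′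
                    (λ {G} {G′} r″ → fin (subst (λ k → R k G G′) (sym (+-suc n m)) r″))) g

Game-vacuous : ∀ {q P} n m → (∀ i → n ≤ i → q i ≡ nothing) → Game q P n m ≡ P
Game-vacuous n zero    h = refl
Game-vacuous n (suc m) h rewrite h n ≤-refl = Game-vacuous (suc n) m (λ i l → h i (<⇒≤ l))

Game-extend : ∀ {q P} n m e → (∀ i → n + m ≤ i → q i ≡ nothing) →
              Game q P n m ≡ Game q P n (m + e)
Game-extend n zero    e h = sym (Game-vacuous n e (λ i l → h i (subst (_≤ i) (sym (+-identityʳ n)) l)))
Game-extend {q} n (suc m) e h =
  cong (quantify (q n) n) (Game-extend (suc n) m e (λ i l → h i (subst (_≤ i) (sym (+-suc n m)) l)))

-- `upTo` is `applyUpTo` of the identity, and its tail applies a shifted function; hence the general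
-- `f`.
prefix-Game : ∀ {q P} n m f → (∀ j → f j ≡ n + j) →
              foldr (λ i → quantify (q i) i) P (applyUpTo f m) ≡ Game q P n m
prefix-Game n zero    f h = refl
prefix-Game {q} n (suc m) f h rewrite trans (h 0) (+-identityʳ n) =
  cong (quantify (q n) n) (prefix-Game (suc n) m (λ j → f (suc j)) (λ j → trans (h (suc j)) (+-suc n j)))

Compatible : (Rank → Conn) → ℕ → Tree → Set
Compatible q N = Every (λ o → conn o ≡ q (rank o) × rank o < N)

-- The prefix depends on `q` and `N` only and not on the tree. Premise and conclusion can thus be
-- judged under the same prefix even if Rule I, read upwards, erases a whole rank.
Winning : Interpretation → (Rank → Conn) → ℕ → Tree → Set
Winning I q N T = Game (just ∘ q) (λ F → eval I F T ≡ true) 0 N (λ _ _ → left)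

-- `rankConn` with the tree abstracted to its list of oconnectives, so that induction on the list is
-- possible.
firstConn : List Oconnective → Rank → Maybe Conn
firstConn os i = Maybe.map conn (head (filter (λ o → rank o ≟ i) os))

firstConn-view : ∀ (q : Rank → Conn) i os → All (λ o → conn o ≡ q (rank o)) os →
  (firstConn os i ≡ nothing × All (λ o → rank o ≢ i) os) ⊎
  (firstConn os i ≡ just (q i) × Any (λ o → rank o ≡ i) os)
firstConn-view q i []       []       = inj₁ (refl , [])
firstConn-view q i (o ∷ os) (e ∷ es) with rank o ≟ i
... | yes refl rewrite filter-accept (λ o → rank o ≟ i) {o} {os} refl =
  inj₂ (cong just e , here refl)
... | no ne rewrite filter-reject (λ o → rank o ≟ i) {o} {os} ne with firstConn-view q i os es
...   | inj₁ (e′ , a) = inj₁ (e′ , ne ∷ a)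
...   | inj₂ (e′ , a) = inj₂ (e′ , there a)

firstConn-∈ : ∀ {o} os → o ∈ os →
  ∃[ o′ ] o′ ∈ os × rank o′ ≡ rank o × firstConn os (rank o) ≡ just (conn o′)
firstConn-∈ {o} (o₁ ∷ os) o∈ with rank o₁ ≟ rank o
... | yes e rewrite filter-accept (λ o′ → rank o′ ≟ rank o) {o₁} {os} e =
  o₁ , here refl , e , refl
... | no ne rewrite filter-reject (λ o′ → rank o′ ≟ rank o) {o₁} {os} ne with o∈
...   | here refl = ⊥-elim (ne refl)
...   | there o∈′ with firstConn-∈ os o∈′
...     | o′ , m , e , e′ = o′ , there m , e , e′

ranks<bound : ∀ os → All (λ o → rank o < suc (foldr _⊔_ 0 (map rank os))) os
ranks<bound []       = []
ranks<bound (o ∷ os) = s≤s (m≤m⊔n (rank o) _) ∷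
  All.map (λ l → ≤-trans l (s≤s (m≤n⊔m (rank o) _))) (ranks<bound os)

-- The default `∧` concerns only ranks without clusters, and no selection made at such a rank is
-- ever consulted.
rankType : Tree → Rank → Conn
rankType T i = fromMaybe ∧ (rankConn T i)

rankType-compatible : ∀ {T N} → Coherent T → rankBound T ≤ N → Compatible (rankType T) N T
rankType-compatible {T} c N≥ = Every-tabulate T λ {o} o∈ →
  (case firstConn-∈ (oconnectives T) o∈ of λ where
    (o′ , o′∈ , e , e′) → trans (sym (Coherent.rank-conn c o′∈ o∈ e)) (sym (cong (fromMaybe ∧) e′)))
  , ≤-trans (All.lookup (ranks<bound (oconnectives T)) o∈) N≥

pick-cong : ∀ {s s′ a a′ b b′} → s ≡ s′ → a ≡ a′ → b ≡ b′ → pick s a b ≡ pick s′ a′ b′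
pick-cong refl refl refl = refl

eval-cong : ∀ {I F F′ T} → Every (λ o → F (rank o) (id o) ≡ F′ (rank o) (id o)) T →
            eval I F T ≡ eval I F′ T
eval-cong lit          = refl
eval-cong (node a e b) = pick-cong e (eval-cong a) (eval-cong b)

rankConn-view : ∀ {q N T} → Compatible q N T → ∀ i →
  (rankConn T i ≡ nothing × Every (λ o → rank o ≢ i) T) ⊎
  (rankConn T i ≡ just (q i) × Any (λ o → rank o ≡ i) (oconnectives T))
rankConn-view {q} {T = T} c i
  with firstConn-view q i (oconnectives T) (Every⇒All (Every-map proj₁ c))
... | inj₁ (e , a) = inj₁ (e , All⇒Every T a)
... | inj₂ x       = inj₂ x

module _ {q : Rank → Conn} {N : ℕ} {T : Tree} (c : Compatible q N T) where

  -- Metaselections may differ at ranks that `T` lacks, which are exactly those quantified in one of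
  -- the two prefixes only.
  Agree : ℕ → Metaselection → Metaselection → Set
  Agree _ F F′ = ∀ r → rankConn T r ≢ nothing → F r ≗ F′ r

  agree-update : ∀ {n F F′} f → Agree n F F′ → Agree (suc n) (F [ n ≔ f ]) (F′ [ n ≔ f ])
  agree-update {n} {F} {F′} f a r h x with r ≟ n
  ... | yes refl = cong-app (trans (update-same F r f) (sym (update-same F′ r f))) x
  ... | no ne    = trans (cong-app (update-other F f ne) x)
                     (trans (a r h x) (sym (cong-app (update-other F′ f ne) x)))

  agree-skipʳ : ∀ {n F F′} f → rankConn T n ≡ nothing → Agree n F F′ → Agree (suc n) F (F′ [ n ≔ f ])
  agree-skipʳ {n} {F} {F′} f z a r h x =
    trans (a r h x) (sym (cong-app (update-other F′ {n} f λ { refl → h z }) x))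

  agree-skipˡ : ∀ {n F F′} f → rankConn T n ≡ nothing → Agree n F F′ → Agree (suc n) (F [ n ≔ f ]) F′
  agree-skipˡ {n} {F} {F′} f z a r h x =
    trans (cong-app (update-other F {n} f λ { refl → h z }) x) (a r h x)

  simulate-total : Simulation (rankConn T) (just ∘ q) Agree
  simulate-total n r k g with rankConn-view c n
  simulate-total n r k g | inj₁ (e , _) rewrite e with q n
  ... | ∧ = λ f → k (agree-skipʳ f e r) g
  -- Rank `n` has no cluster in `T`, so any selection answers the additional quantifier.
  ... | ∨ = (λ _ → left) , k (agree-skipʳ _ e r) g
  simulate-total n r k g | inj₂ (e , _) rewrite e with q n
  ... | ∧ = λ f → k (agree-update f r) (g f)
  ... | ∨ = proj₁ g , k (agree-update _ r) (proj₂ g)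

  simulate-partial : Simulation (just ∘ q) (rankConn T) Agree
  simulate-partial n r k g with rankConn-view c n
  simulate-partial n r k g | inj₁ (e , _) rewrite e with q n
  ... | ∧ = k (agree-skipˡ (λ _ → left) e r) (g (λ _ → left))
  ... | ∨ = k (agree-skipˡ _ e r) (proj₂ g)
  simulate-partial n r k g | inj₂ (e , _) rewrite e with q n
  ... | ∧ = λ f → k (agree-update f r) (g f)
  ... | ∨ = proj₁ g , k (agree-update _ r) (proj₂ g)

  agree-eval : ∀ {I n F F′} → Agree n F F′ → eval I F T ≡ eval I F′ T
  agree-eval a = eval-cong (Every-tabulate T λ {o} o∈ →
    a (rank o) (λ z → case rankConn-view c (rank o) of λ where
      (inj₁ (_ , ne)) → Every-lookup ne o∈ refl
      (inj₂ (e , _))  → case trans (sym z) e of λ ()) (id o))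

  TrueUnder≡Game : ∀ I → rankBound T ≤ N →
    TrueUnder I T ≡ Game (rankConn T) (λ F → Metatrue I F T) 0 N (λ _ _ → left)
  TrueUnder≡Game I l = cong-app (trans
    (prefix-Game {rankConn T} {λ F → Metatrue I F T} 0 (rankBound T) (λ j → j) (λ _ → refl))
    (trans (Game-extend 0 (rankBound T) (N ∸ rankBound T) unused)
      (cong (Game (rankConn T) (λ F → Metatrue I F T) 0) (m+[n∸m]≡n l)))) (λ _ _ → left)
    where
    unused : ∀ i → rankBound T ≤ i → rankConn T i ≡ nothing
    unused i l with rankConn-view c i
    ... | inj₁ (e , _) = e
    ... | inj₂ (_ , a) = let x , e = All.lookupAny (ranks<bound (oconnectives T)) a
                       in ⊥-elim (<-irrefl e (≤-trans x l))

  TrueUnder⇒Winning : ∀ I → rankBound T ≤ N → TrueUnder I T → Winning I q N T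
  TrueUnder⇒Winning I l t = Game-simulate {R = Agree} simulate-total 0 N (λ _ _ _ → refl)
    (λ a m → trans (sym (agree-eval {n = N} a)) (Metatrue⇒eval m))
    (subst (λ X → X) (TrueUnder≡Game I l) t)

  Winning⇒TrueUnder : ∀ I → rankBound T ≤ N → Winning I q N T → TrueUnder I T
  Winning⇒TrueUnder I l w = subst (λ X → X) (sym (TrueUnder≡Game I l))
    (Game-simulate {R = Agree} simulate-partial 0 N (λ _ _ _ → refl)
      (λ a e → eval⇒Metatrue T (trans (sym (agree-eval {n = N} a)) e)) w)

-- Renaming of IDs and translation of metaselections

-- The rules change IDs occurrence by occurrence, so this is a relation between trees and no
-- function on IDs is presupposed; `matching` below extracts functions where they exist.
data Alike (R : Rank → ID → ID → Set) : Tree → Tree → Set where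
  lit  : ∀ {L} → Alike R (lit L) (lit L)
  node : ∀ {A A′ B B′ c x y r} → Alike R A A′ → R r x y → Alike R B B′ →
         Alike R (A ⟨ c [ x ^ r ] ⟩ B) (A′ ⟨ c [ y ^ r ] ⟩ B′)

Alike-map : ∀ {R S T T′} → (∀ {r x y} → R r x y → S r x y) → Alike R T T′ → Alike S T T′
Alike-map f lit          = lit
Alike-map f (node a x b) = node (Alike-map f a) (f x) (Alike-map f b)

Alike-sym : ∀ {R T T′} → Alike R T T′ → Alike (λ r x y → R r y x) T′ T
Alike-sym lit          = lit
Alike-sym (node a x b) = node (Alike-sym a) x (Alike-sym b)

Alike-every : ∀ {R T} → Every (λ o → R (rank o) (id o) (id o)) T → Alike R T T
Alike-every lit          = lit
Alike-every (node a x b) = node (Alike-every a) x (Alike-every b)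

Alike-refl : ∀ {R} → (∀ {r x} → R r x x) → ∀ T → Alike R T T
Alike-refl f T = Alike-every (Every-tabulate T λ _ → f)

-- Filling the hole with a literal lets `Every` speak of the context alone.
Alike-plug : ∀ {R T T′ L} Φ → Every (λ o → R (rank o) (id o) (id o)) (Φ ⟦ lit L ⟧) →
             Alike R T T′ → Alike R (Φ ⟦ T ⟧) (Φ ⟦ T′ ⟧)
Alike-plug hole            e            t = t
Alike-plug (leftOf Φ o B)  (node a x b) t = node (Alike-plug Φ a t) x (Alike-every b)
Alike-plug (rightOf A o Φ) (node a x b) t = node (Alike-every a) x (Alike-plug Φ b t)

Alike-restrict : ∀ {R p T T′} → Every p T → Alike R T T′ →
  Alike (λ r x y → R r x y × ∃[ c ] p (c [ x ^ r ])) T T′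
Alike-restrict lit lit = lit
Alike-restrict (node a p b) (node {c = c} a′ x b′) =
  node (Alike-restrict a a′) (x , c , p) (Alike-restrict b b′)

eval-alike : ∀ {I F F′ T T′} → Alike (λ r x y → F r x ≡ F′ r y) T T′ → eval I F T ≡ eval I F′ T′
eval-alike lit          = refl
eval-alike (node a e b) = pick-cong e (eval-alike a) (eval-alike b)

-- A player who knows the selection at k, made at rank i, can translate a
-- metaselection for one tree into one for the other: at the ranks from i on
-- IDs are translated by fwd and bwd, in a way depending on that selection.
record Linked (i : Rank) (k : ID) (fwd bwd : Side → ID → ID)
              (n : ℕ) (F F′ : Metaselection) : Set where
  constructor linked
  field
    before : ∀ r → r < n → r < i → F r ≗ F′ r
    at     : i < n → F i k ≡ F′ i k
    after  : ∀ r → r < n → i ≤ r → ∀ x y →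
             fwd (F i k) x ≡ y → bwd (F i k) y ≡ x → F r x ≡ F′ r y

open Linked

-- Both players read the same selection at `k`, by `at`, so the roles of `fwd` and `bwd` can be
-- exchanged. Thanks to this one construction, `respond`, serves both kinds of quantifier.
Linked-sym : ∀ {i k fwd bwd n F F′} → Linked i k fwd bwd n F F′ → Linked i k bwd fwd n F′ F
Linked-sym {i} {k} {fwd} {bwd} l .before r a b x = sym (before l r a b x)
Linked-sym l .at a = sym (at l a)
Linked-sym {i} {k} {fwd} {bwd} l .after r r<n i≤r x y e e′ =
  sym (after l r r<n i≤r y x (subst (λ s → fwd s y ≡ x) s≡ e′) (subst (λ s → bwd s x ≡ y) s≡ e))
  where s≡ = sym (at l (≤-trans (s≤s i≤r) r<n))

-- Below rank `i` the selection is copied; from `i` on it is pulled back along the translation that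
-- belongs to the selection at `k`. Since `bwd` fixes `k`, the pull-back at rank `i` itself does not
-- disturb that selection, and both sides go on to use the same translation.
respond : ∀ {i k fwd bwd n F F′} → (∀ s → bwd s k ≡ k) → Linked i k fwd bwd n F F′ →
  ∀ f → ∃[ f′ ] Linked i k fwd bwd (suc n) (F [ n ≔ f ]) (F′ [ n ≔ f′ ])
respond {i} {k} {fwd} {bwd} {n} {F} {F′} bwd-k l f with n <? i
... | yes n<i = f , linked bef (λ i<sn → ⊥-elim (<-irrefl refl (≤-trans i<sn n<i)))
                      (λ r r<sn i≤r → ⊥-elim (<-irrefl refl (≤-trans r<sn (≤-trans n<i i≤r))))
  where
  bef : ∀ r → r < suc n → r < i → (F [ n ≔ f ]) r ≗ (F′ [ n ≔ f ]) r
  bef r r<sn r<i x with r ≟ n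
  ... | yes refl = cong-app (trans (update-same F r f) (sym (update-same F′ r f))) x
  ... | no ne    = trans (cong-app (update-other F f ne) x)
                     (trans (before l r (≤∧≢⇒< (≤-pred r<sn) ne) r<i x)
                       (sym (cong-app (update-other F′ f ne) x)))
... | no n≮i = f′ , linked bef at′ aft
  where
  i≤n = ≮⇒≥ n≮i
  G  = F [ n ≔ f ]
  -- The selection at `k` is read from `G` and not from `F`: if `n` is `i`, it is `f` that makes it.
  f′ = λ y → f (bwd (G i k) y)
  G′ = F′ [ n ≔ f′ ]
  bef : ∀ r → r < suc n → r < i → G r ≗ G′ r
  bef r r<sn r<i x = trans (cong-app (update-other F f ne) x)
                     (trans (before l r r<n r<i x) (sym (cong-app (update-other F′ f′ ne) x)))
    where
    r<n = ≤-trans r<i i≤n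
    ne : r ≢ n
    ne e = <-irrefl e r<n
  at′ : i < suc n → G i k ≡ G′ i k
  at′ i<sn with i ≟ n
  ... | yes refl = trans (cong-app (update-same F i f) k)
                     (trans (cong f (sym (bwd-k (G i k)))) (sym (cong-app (update-same F′ i f′) k)))
  ... | no ne    = trans (cong-app (update-other F f ne) k)
                     (trans (at l (≤∧≢⇒< i≤n ne)) (sym (cong-app (update-other F′ f′ ne) k)))
  aft : ∀ r → r < suc n → i ≤ r → ∀ x y → fwd (G i k) x ≡ y → bwd (G i k) y ≡ x → G r x ≡ G′ r y
  aft r r<sn i≤r x y e e′ with r ≟ n
  ... | yes refl = trans (cong-app (update-same F r f) x)
                     (trans (cong f (sym e′)) (sym (cong-app (update-same F′ r f′) y)))
  ... | no ne    = trans (cong-app (update-other F f ne) x)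
      (trans (after l r r<n i≤r x y (subst (λ s → fwd s x ≡ y) s≡ e) (subst (λ s → bwd s y ≡ x) s≡ e′))
        (sym (cong-app (update-other F′ f′ ne) y)))
    where
    r<n = ≤∧≢⇒< (≤-pred r<sn) ne
    s≡ : G i k ≡ F i k
    s≡ = cong-app (update-other F f (λ e → <-irrefl e (≤-trans (s≤s i≤r) r<n))) k

-- At an existential rank the given selection is translated forwards; at a universal rank the
-- selection met in the second game is translated backwards, to be put to the first.
Linked-simulation : ∀ {i k fwd bwd} q → (∀ s → fwd s k ≡ k) → (∀ s → bwd s k ≡ k) →
                    Simulation (just ∘ q) (just ∘ q) (Linked i k fwd bwd)
Linked-simulation q fwd-k bwd-k n l step g with q n
... | ∧ = λ f′ → let f , l′ = respond fwd-k (Linked-sym l) f′ in step (Linked-sym l′) (g f)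
... | ∨ = let f , s = g ; f′ , l′ = respond bwd-k l f in f′ , step l′ s

eval-branch : ∀ {I F c k i s} Φ {X Y} → F i k ≡ s →
  eval I F (Φ ⟦ X ⟨ c [ k ^ i ] ⟩ Y ⟧) ≡ eval I F (Φ ⟦ select s X Y ⟧)
eval-branch {s = left}  Φ e = eval-plug Φ (pick-cong e refl refl)
eval-branch {s = right} Φ e = eval-plug Φ (pick-cong e refl refl)

Ranked : ℕ → Tree → Set
Ranked N = Every (λ o → rank o < N)

-- IDs of rank below `i` must stay fixed, as the selection at `k` is still unknown when they are
-- due. The two equations ask `fwd` and `bwd` to be inverse only on IDs that actually correspond.
Translates : Rank → (fwd bwd : ID → ID) → Rank → ID → ID → Set
Translates i fwd bwd r x y = (r < i → x ≡ y) × fwd x ≡ y × bwd y ≡ x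

Every-subtree : ∀ {p T} Φ → Every p (Φ ⟦ T ⟧) → Every p T
Every-subtree hole            e            = e
Every-subtree (leftOf Φ o B)  (node a x b) = Every-subtree Φ a
Every-subtree (rightOf A o Φ) (node a x b) = Every-subtree Φ b

branch : ∀ {p X o Y} Φ s → Every p (Φ ⟦ X ⟨ o ⟩ Y ⟧) → Every p (Φ ⟦ select s X Y ⟧)
branch Φ left  = Every-plug Φ (λ { (node a x b) → a }) (λ h → h)
branch Φ right = Every-plug Φ (λ { (node a x b) → b }) (λ h → h)

-- Once the selection at `k` is known, only one branch of the displayed node counts. So the trees to
-- be compared are `Φ` filled with a single branch, and the two branches may use unrelated
-- translations.
Winning-translate : ∀ {I q N c k i X Y X′ Y′} Φ (fwd bwd : Side → ID → ID) →
  (∀ s → fwd s k ≡ k) → (∀ s → bwd s k ≡ k) →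
  (∀ s → Alike (Translates i (fwd s) (bwd s)) (Φ ⟦ select s X Y ⟧) (Φ ⟦ select s X′ Y′ ⟧)) →
  Ranked N (Φ ⟦ X ⟨ c [ k ^ i ] ⟩ Y ⟧) →
  Winning I q N (Φ ⟦ X ⟨ c [ k ^ i ] ⟩ Y ⟧) → Winning I q N (Φ ⟦ X′ ⟨ c [ k ^ i ] ⟩ Y′ ⟧)
Winning-translate {I} {q} {N} {c} {k} {i} {X} {Y} {X′} {Y′} Φ fwd bwd fwd-k bwd-k alike ranked =
  Game-simulate {R = Linked i k fwd bwd} (Linked-simulation q fwd-k bwd-k) 0 N
    (linked (λ _ ()) (λ ()) (λ _ ()))
    (λ {F} {F′} l e → trans (sym (same l)) e)
  where
  i<N : i < N
  i<N with Every-subtree Φ ranked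
  ... | node _ l _ = l
  same : ∀ {F F′} → Linked i k fwd bwd N F F′ →
         eval I F (Φ ⟦ X ⟨ c [ k ^ i ] ⟩ Y ⟧) ≡ eval I F′ (Φ ⟦ X′ ⟨ c [ k ^ i ] ⟩ Y′ ⟧)
  same {F} {F′} l = trans (eval-branch Φ refl)
    (trans (eval-alike (Alike-map agree (Alike-restrict (branch Φ s ranked) (alike s))))
           (sym (eval-branch Φ (sym (at l i<N)))))
    where
    s = F i k
    agree : ∀ {r x y} → Translates i (fwd s) (bwd s) r x y × ∃[ c ] rank (c [ x ^ r ]) < N → F r x ≡ F′ r y
    agree {r} {x} {y} ((b , e , e′) , _ , r<N) with r <? i
    ... | yes r<i = trans (before l r r<N r<i x) (cong (F′ r) (b r<i))
    ... | no r≮i  = after l r r<N (≮⇒≥ r≮i) x y e e′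

-- Partial bijections between IDs, given by their graphs.

Graph : Set
Graph = List (ID × ID)

occ : (ID × ID → ID) → ID → Graph → ℕ
occ f x []      = 0
occ f x (p ∷ L) = δ x (f p) + occ f x L

occ-++ : ∀ f x L M → occ f x (L ++ M) ≡ occ f x L + occ f x M
occ-++ f x []      M = refl
occ-++ f x (p ∷ L) M = trans (cong (δ x (f p) +_) (occ-++ f x L M)) (sym (+-assoc (δ x (f p)) _ _))

occ-∈ : ∀ f {p} L → p ∈ L → 1 ≤ occ f (f p) L
occ-∈ f (p ∷ L) (here refl) = ≤-trans (≤-reflexive (sym (δ-≡ {f p} refl))) (m≤m+n _ _)
occ-∈ f (p ∷ L) (there p∈)  = ≤-trans (occ-∈ f L p∈) (m≤n+m _ _)

occ-unique : ∀ f {x p p′} L → occ f x L ≤ 1 → p ∈ L → p′ ∈ L → f p ≡ x → f p′ ≡ x → p ≡ p′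
occ-unique f (p ∷ L) l (here refl) (here refl) e e′ = refl
occ-unique f (p ∷ L) l (here refl) (there p′∈) refl e′ =
  ⊥-elim (<-irrefl refl (≤-trans (+-mono-≤ (≤-reflexive (sym (δ-≡ {f p} refl)))
    (≤-trans (occ-∈ f L p′∈) (≤-reflexive (cong (λ z → occ f z L) e′)))) l))
occ-unique f (p ∷ L) l (there p∈) (here refl) e refl =
  ⊥-elim (<-irrefl refl (≤-trans (+-mono-≤ (≤-reflexive (sym (δ-≡ {f p} refl)))
    (≤-trans (occ-∈ f L p∈) (≤-reflexive (cong (λ z → occ f z L) e)))) l))
occ-unique f (p ∷ L) l (there p∈) (there p′∈) e e′ = occ-unique f L (≤-trans (m≤n+m _ _) l) p∈ p′∈ e e′

image : (f g : ID × ID → ID) → Graph → ID → ID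
image f g []      x = x
image f g (p ∷ L) x = if does (f p ≟ x) then g p else image f g L x

image-∈ : ∀ f g {p} L → p ∈ L → (∀ {p′} → p′ ∈ L → f p′ ≡ f p → g p′ ≡ g p) →
          image f g L (f p) ≡ g p
image-∈ f g {p} (p₁ ∷ L) p∈ h with f p₁ ≟ f p
... | yes e rewrite dec-true (f p₁ ≟ f p) e = h (here refl) e
... | no ne rewrite dec-false (f p₁ ≟ f p) ne with p∈
...   | here refl = ⊥-elim (ne refl)
...   | there p∈′ = image-∈ f g L p∈′ (λ m → h (there m))

graph : ∀ {R T T′} → Alike R T T′ → Graph
graph lit                          = []
graph (node {x = x} {y = y} a _ b) = graph a ++ (x , y) ∷ graph b

occ-graphˡ : ∀ {R T T′} x (t : Alike R T T′) → occ proj₁ x (graph t) ≡ cnt x T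
occ-graphˡ x lit          = refl
occ-graphˡ x (node {x = z} a _ b) = trans (occ-++ proj₁ x (graph a) _)
  (cong₂ _+_ (occ-graphˡ x a) (cong (δ x z +_) (occ-graphˡ x b)))

occ-graphʳ : ∀ {R T T′} x (t : Alike R T T′) → occ proj₂ x (graph t) ≡ cnt x T′
occ-graphʳ x lit          = refl
occ-graphʳ x (node {y = z} a _ b) = trans (occ-++ proj₂ x (graph a) _)
  (cong₂ _+_ (occ-graphʳ x a) (cong (δ x z +_) (occ-graphʳ x b)))

graph-∈ : ∀ {R T T′} (t : Alike R T T′) → Alike (λ r x y → R r x y × (x , y) ∈ graph t) T T′
graph-∈ lit          = lit
graph-∈ (node a x b) =
  node (Alike-map (λ (h , m) → h , ∈-++⁺ˡ m) (graph-∈ a))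
       (x , ∈-++⁺ʳ (graph a) (here refl))
       (Alike-map (λ (h , m) → h , ∈-++⁺ʳ (graph a) (there m)) (graph-∈ b))

graph-All : ∀ {R : Rank → ID → ID → Set} {T T′} {p : ID × ID → Set} →
  (∀ {r x y} → R r x y → p (x , y)) → (t : Alike R T T′) → All p (graph t)
graph-All f lit          = []
graph-All f (node a x b) = ++⁺ (graph-All f a) (f x ∷ graph-All f b)

-- If an ID occurs at most once on its side, the pair in which it occurs is determined by it; all
-- remaining pairs are diagonal. Hence the graph is functional in both directions and can be read as
-- two mutually inverse maps.
matching : ∀ {R T T′} → Alike R T T′ →
  (∀ {r x y} → R r x y → x ≡ y ⊎ (cnt x T ≤ 1 × cnt y T′ ≤ 1)) →
  ∃[ fwd ] ∃[ bwd ] Alike (λ r x y → R r x y × fwd x ≡ y × bwd y ≡ x) T T′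
matching {R} {T} {T′} t h =
  image proj₁ proj₂ L , image proj₂ proj₁ L ,
  Alike-map (λ {r} {x} {y} (rel , m) →
    rel , image-∈ proj₁ proj₂ L m (λ m′ e → functional m′ m e)
        , image-∈ proj₂ proj₁ L m (λ m′ e → injective m′ m e))
    (graph-∈ t)
  where
  L = graph t
  good : All (λ (x , y) → x ≡ y ⊎ (cnt x T ≤ 1 × cnt y T′ ≤ 1)) L
  good = graph-All h t
  functional : ∀ {p p′} → p ∈ L → p′ ∈ L → proj₁ p ≡ proj₁ p′ → proj₂ p ≡ proj₂ p′
  functional m m′ e with All.lookup good m | All.lookup good m′
  ... | inj₁ e₁ | inj₁ e₂ = trans (sym e₁) (trans e e₂)
  ... | inj₂ (c , _) | _ = cong proj₂ (occ-unique proj₁ L (≤-trans (≤-reflexive (occ-graphˡ _ t)) c) m m′ refl (sym e))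
  ... | inj₁ _ | inj₂ (c , _) = cong proj₂ (occ-unique proj₁ L (≤-trans (≤-reflexive (occ-graphˡ _ t)) c) m m′ e refl)
  injective : ∀ {p p′} → p ∈ L → p′ ∈ L → proj₂ p ≡ proj₂ p′ → proj₁ p ≡ proj₁ p′
  injective m m′ e with All.lookup good m | All.lookup good m′
  ... | inj₁ e₁ | inj₁ e₂ = trans e₁ (trans e (sym e₂))
  ... | inj₂ (_ , c) | _ = cong proj₁ (occ-unique proj₂ L (≤-trans (≤-reflexive (occ-graphʳ _ t)) c) m m′ refl (sym e))
  ... | inj₁ _ | inj₂ (_ , c) = cong proj₁ (occ-unique proj₂ L (≤-trans (≤-reflexive (occ-graphʳ _ t)) c) m m′ e refl)

-- Classical trees

-- The side chosen always has the truth value of the whole compound: a false conjunct if the left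
-- one is false, a true disjunct if the left one is true, and otherwise the right side, on which the
-- value then depends.
prefer : Conn → Bool → Side
prefer ∧ a = if a then right else left
prefer ∨ a = if a then left else right

data Optimal (I : Interpretation) (g : ID → Side) : Tree → Set where
  lit  : ∀ {L} → Optimal I g (lit L)
  node : ∀ {A o B} → Optimal I g A → g (id o) ≡ prefer (conn o) (⟦ erase A ⟧ᶠ I) →
         Optimal I g B → Optimal I g (A ⟨ o ⟩ B)

Optimal-cong : ∀ {I g h T} → Every (λ o → g (id o) ≡ h (id o)) T →
               Optimal I g T → Optimal I h T
Optimal-cong lit lit = lit
Optimal-cong (node a e b) (node a′ e′ b′) =
  node (Optimal-cong a a′) (trans (sym e) e′) (Optimal-cong b b′)

-- No ID occurs twice, so the selections wanted by `A`, by the root and by `B` concern disjoint sets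
-- of IDs and can be glued. A single `g` serves both players, since each ID belongs to one of them.
optimal : ∀ I T → (∀ x → cnt x T ≤ 1) → ∃[ g ] Optimal I g T
optimal I (lit L)     u = (λ _ → left) , lit
optimal I (A ⟨ o ⟩ B) u
  with optimal I A (λ x → ≤-trans (cnt-left {x} {A} {o} {B}) (u x))
     | optimal I B (λ x → ≤-trans (cnt-right {x} {A} {o} {B}) (u x))
... | gA , optA | gB , optB = g ,
  node (Optimal-cong (Every-map (λ {o′} l → sym (g-A (id o′) l)) (Every-occurs A)) optA)
       g-o
       (Optimal-cong (Every-map (λ {o′} l → sym (g-B (id o′) l)) (Every-occurs B)) optB)
  where
  k = id o
  g : ID → Side
  g x = if does (k ≟ x) then prefer (conn o) (⟦ erase A ⟧ᶠ I)
        else if does (1 ≤? cnt x A) then gA x else gB x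
  g-o : g k ≡ prefer (conn o) (⟦ erase A ⟧ᶠ I)
  g-o rewrite dec-true (k ≟ k) refl = refl
  g-A : ∀ x → 1 ≤ cnt x A → g x ≡ gA x
  g-A x l rewrite dec-false (k ≟ x) (λ e → <-irrefl refl (≤-trans (+-mono-≤ l
                    (≤-trans (≤-reflexive (sym (δ-≡ e))) (m≤m+n _ (cnt x B)))) (u x)))
                | dec-true (1 ≤? cnt x A) l = refl
  g-B : ∀ x → 1 ≤ cnt x B → g x ≡ gB x
  g-B x l rewrite dec-false (k ≟ x) (λ e → <-irrefl refl (≤-trans (≤-trans (+-mono-≤
                    (≤-reflexive (sym (δ-≡ e))) l) (m≤n+m _ (cnt x A))) (u x)))
                | dec-false (1 ≤? cnt x A) (λ l′ → <-irrefl refl (≤-trans (+-mono-≤ l′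
                    (≤-trans l (m≤n+m _ (δ x k)))) (u x))) = refl

Plays : (Rank → Conn) → Conn → (ID → Side) → ℕ → Metaselection → Set
Plays q c g n F = ∀ r → r < n → q r ≡ c → F r ≗ g

Plays-update : ∀ {q c g n F f} → Plays q c g n F → (q n ≡ c → f ≗ g) → Plays q c g (suc n) (F [ n ≔ f ])
Plays-update {n = n} {F} {f} p h r r<sn e x with r ≟ n
... | yes refl = trans (cong-app (update-same F r f) x) (h e x)
... | no ne    = trans (cong-app (update-other F f ne) x) (p r (≤∧≢⇒< (≤-pred r<sn) ne) e x)

Game-win : ∀ {q g P} n m {F} → Plays q ∨ g n F → (∀ {G} → Plays q ∨ g (n + m) G → P G) →
           Game (just ∘ q) P n m F
Game-win {q} {g} n zero    p h = h (subst (λ k → Plays q ∨ g k _) (sym (+-identityʳ n)) p)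
Game-win {q} {g} n (suc m) p h with q n in e
... | ∧ = λ f → Game-win {q} {g} (suc n) m (Plays-update p (λ e′ → case trans (sym e) e′ of λ ()))
                  (λ {G} p′ → h (subst (λ k → Plays q ∨ g k G) (sym (+-suc n m)) p′))
... | ∨ = g , Game-win {q} {g} (suc n) m (Plays-update p (λ _ _ → refl))
                  (λ {G} p′ → h (subst (λ k → Plays q ∨ g k G) (sym (+-suc n m)) p′))

-- One play suffices against a supposed win: universal quantifiers are instantiated with `g`,
-- existential ones are opened. No appeal to determinacy of the game is made.
Game-refute : ∀ {q P} g n m {F} → Plays q ∧ g n F → Game (just ∘ q) P n m F →
              ∃[ G ] Plays q ∧ g (n + m) G × P G
Game-refute {q} g n zero {F}    p w = F , subst (λ k → Plays q ∧ g k F) (sym (+-identityʳ n)) p , w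
Game-refute {q} g n (suc m) p w with q n in e
... | ∧ = let G , p′ , x = Game-refute {q} g (suc n) m (Plays-update p (λ _ _ → refl)) (w g)
          in G , subst (λ k → Plays q ∧ g k G) (sym (+-suc n m)) p′ , x
... | ∨ = let G , p′ , x = Game-refute {q} g (suc n) m
                             (Plays-update p (λ e′ → case trans (sym e) e′ of λ ())) (proj₂ w)
          in G , subst (λ k → Plays q ∧ g k G) (sym (+-suc n m)) p′ , x

module _ {I : Interpretation} {q : Rank → Conn} {N : ℕ} {g : ID → Side} where

  -- At a conjunction both sides are true, so the opponent's selection is harmless; at a disjunction
  -- `g` selects a true side.
  eval-true : ∀ {T F} → Compatible q N T → Optimal I g T → Plays q ∨ g N F →
              ⟦ erase T ⟧ᶠ I ≡ true → eval I F T ≡ true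
  eval-true lit lit p e = e
  eval-true {A ⟨ ∧ [ k ^ r ] ⟩ B} {F} (node a (c , l) b) (node oa s ob) p e with ⟦ erase A ⟧ᶠ I in ea
  ... | true with F r k
  ...   | left  = eval-true a oa p ea
  ...   | right = eval-true b ob p e
  eval-true {A ⟨ ∨ [ k ^ r ] ⟩ B} {F} (node a (c , l) b) (node oa s ob) p e
    rewrite trans (p r l (sym c) k) s with ⟦ erase A ⟧ᶠ I in ea
  ... | true  = eval-true a oa p ea
  ... | false = eval-true b ob p e

  eval-false : ∀ {T F} → Compatible q N T → Optimal I g T → Plays q ∧ g N F →
               ⟦ erase T ⟧ᶠ I ≡ false → eval I F T ≡ false
  eval-false lit lit p e = e
  eval-false {A ⟨ ∨ [ k ^ r ] ⟩ B} {F} (node a (c , l) b) (node oa s ob) p e with ⟦ erase A ⟧ᶠ I in ea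
  ... | false with F r k
  ...   | left  = eval-false a oa p ea
  ...   | right = eval-false b ob p e
  eval-false {A ⟨ ∧ [ k ^ r ] ⟩ B} {F} (node a (c , l) b) (node oa s ob) p e
    rewrite trans (p r l (sym c) k) s with ⟦ erase A ⟧ᶠ I in ea
  ... | true  = eval-false b ob p e
  ... | false = eval-false a oa p ea

tautology⇒Winning : ∀ {q N T} I → Compatible q N T → (∀ x → cnt x T ≤ 1) →
                    ⟦ erase T ⟧ᶠ I ≡ true → Winning I q N T
tautology⇒Winning {q} {N} {T} I c u e with optimal I T u
... | g , opt = Game-win {q} {g} 0 N (λ _ ()) (λ p → eval-true c opt p e)

Winning⇒tautology : ∀ {q N T} I → Compatible q N T → (∀ x → cnt x T ≤ 1) →
                    Winning I q N T → ⟦ erase T ⟧ᶠ I ≡ true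
Winning⇒tautology {q} {N} {T} I c u w with ⟦ erase T ⟧ᶠ I in e
... | true  = refl
... | false with optimal I T u
...   | g , opt with Game-refute {q} g 0 N (λ _ ()) w
...     | G , p , t = trans (sym (eval-false c opt p e)) t

-- Preservation of truth by the rules in both directions

-- Naming the difference turns an inequality between counts into an equation for the ring solver.
≤-by : ∀ {m n} d → m + d ≡ n → m ≤ n
≤-by {m} d e = subst (m ≤_) e (m≤m+n m d)

Winning-pointwise : ∀ {I q N P Q} → (∀ F → eval I F P ≡ eval I F Q) → Winning I q N P → Winning I q N Q
Winning-pointwise {I} {q} {N} e =
  Game-simulate {R = λ _ → _≡_} same 0 N refl (λ { {F} refl p → trans (sym (e F)) p })
  where
  same : Simulation (just ∘ q) (just ∘ q) (λ _ → _≡_)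
  same n refl k g with q n
  ... | ∧ = λ f → k refl (g f)
  ... | ∨ = proj₁ g , k refl (proj₂ g)

infix 4 _≋_

-- Evaluation does not look at the types of connectives, so the equivalence can be demanded for
-- every assignment `q` of quantifiers to ranks. Only the bound on ranks remains as a condition.
record _≋_ (P Q : Tree) : Set where
  field
    to   : ∀ {I q N} → Ranked N P → Ranked N Q → Winning I q N P → Winning I q N Q
    from : ∀ {I q N} → Ranked N P → Ranked N Q → Winning I q N Q → Winning I q N P

open _≋_

≋-pointwise : ∀ {P Q} → (∀ I F → eval I F P ≡ eval I F Q) → P ≋ Q
≋-pointwise {P} {Q} e .to   {I} {q} {N} _ _ = Winning-pointwise {I} {q} {N} {P} {Q} (e I)
≋-pointwise {P} {Q} e .from {I} {q} {N} _ _ = Winning-pointwise {I} {q} {N} {Q} {P} (λ F → sym (e I F))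

≋-translate : ∀ {c k i X Y X′ Y′} Φ (fwd bwd : Side → ID → ID) →
  (∀ s → fwd s k ≡ k) → (∀ s → bwd s k ≡ k) →
  (∀ s → Alike (Translates i (fwd s) (bwd s)) (Φ ⟦ select s X Y ⟧) (Φ ⟦ select s X′ Y′ ⟧)) →
  Φ ⟦ X ⟨ c [ k ^ i ] ⟩ Y ⟧ ≋ Φ ⟦ X′ ⟨ c [ k ^ i ] ⟩ Y′ ⟧
≋-translate Φ fwd bwd fwd-k bwd-k t .to r r′ = Winning-translate Φ fwd bwd fwd-k bwd-k t r
≋-translate {i = i} Φ fwd bwd fwd-k bwd-k t .from r r′ =
  Winning-translate Φ bwd fwd bwd-k fwd-k
    (λ s → Alike-map (λ (b , e , e′) → (λ l → sym (b l)) , e′ , e) (Alike-sym (t s))) r′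

Once : ID → Tree → Set
Once x T = cnt x T ≡ 1

Duplicates : Rank → (once once′ : ID → Set) → Rank → ID → ID → Set
Duplicates i once once′ r x y = x ≡ y ⊎ (i ≤ r × once x × once′ y)

-- Each branch is matched with its counterpart on its own, which gives one translation per selection
-- at `k`. The root of index `k`, of rank `i`, put on top of each branch, with a dummy literal,
-- makes `k` take part in the matching as a diagonal pair, so that the resulting translations fix
-- it.
≋-duplicate : ∀ {c k i X Y X′ Y′} Φ (once once′ : ID → Set) →
  (∀ {x} s → once x → cnt x ((Φ ⟦ select s X Y ⟧) ⟨ c [ k ^ i ] ⟩ lit (pos 0)) ≤ 1) →
  (∀ {x} s → once′ x → cnt x ((Φ ⟦ select s X′ Y′ ⟧) ⟨ c [ k ^ i ] ⟩ lit (pos 0)) ≤ 1) →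
  Alike (Duplicates i once once′) X X′ → Alike (Duplicates i once once′) Y Y′ →
  Φ ⟦ X ⟨ c [ k ^ i ] ⟩ Y ⟧ ≋ Φ ⟦ X′ ⟨ c [ k ^ i ] ⟩ Y′ ⟧
≋-duplicate {c} {k} {i} {X} {Y} {X′} {Y′} Φ once once′ u u′ x y =
  ≋-translate Φ fwd bwd fwd-k bwd-k alike
  where
  D = Duplicates i once once′
  side : ∀ s → Alike D ((Φ ⟦ select s X Y ⟧) ⟨ c [ k ^ i ] ⟩ lit (pos 0))
                       ((Φ ⟦ select s X′ Y′ ⟧) ⟨ c [ k ^ i ] ⟩ lit (pos 0))
  side left  = node (Alike-plug {L = pos 0} Φ (Every-tabulate _ (λ _ → inj₁ refl)) x) (inj₁ refl) lit
  side right = node (Alike-plug {L = pos 0} Φ (Every-tabulate _ (λ _ → inj₁ refl)) y) (inj₁ refl) lit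
  match : ∀ s → _
  match s = matching (side s) λ { (inj₁ e) → inj₁ e ; (inj₂ (_ , a , b)) → inj₂ (u s a , u′ s b) }
  fwd bwd : Side → ID → ID
  fwd s = proj₁ (match s)
  bwd s = proj₁ (proj₂ (match s))
  fwd-k : ∀ s → fwd s k ≡ k
  fwd-k s with node _ (_ , e , _) _ ← proj₂ (proj₂ (match s)) = e
  bwd-k : ∀ s → bwd s k ≡ k
  bwd-k s with node _ (_ , _ , e) _ ← proj₂ (proj₂ (match s)) = e
  alike : ∀ s → Alike (Translates i (fwd s) (bwd s)) (Φ ⟦ select s X Y ⟧) (Φ ⟦ select s X′ Y′ ⟧)
  alike s with node a _ _ ← proj₂ (proj₂ (match s)) =
    Alike-map (λ { (inj₁ e , f) → (λ _ → e) , f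
                 ; (inj₂ (i≤r , _) , f) → (λ r<i → ⊥-elim (<-irrefl refl (≤-trans r<i i≤r))) , f }) a

≋-trans : ∀ {P R Q} → (∀ {N} → Ranked N Q → Ranked N R) → P ≋ R → R ≋ Q → P ≋ Q
≋-trans h a b .to   p q w = to b (h q) q (to a p (h q) w)
≋-trans h a b .from p q w = from a p (h q) (from b (h q) q w)

≋-sym : ∀ {P Q} → P ≋ Q → Q ≋ P
≋-sym a .to   p q = from a q p
≋-sym a .from p q = to a q p

Refreshed⇒Alike : ∀ {P Q C C′ i} → Refreshed P Q C C′ → Every (λ o → i ≤ rank o) C →
  Alike (Duplicates i (λ x → Singleton x Q) (λ y → Singleton y P)) C C′
Refreshed⇒Alike lit lit = lit
Refreshed⇒Alike (replace s s′ x y) (node a l b) =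
  node (Refreshed⇒Alike x a) (inj₂ (l , s , s′)) (Refreshed⇒Alike y b)
Refreshed⇒Alike (keep s x y) (node a l b) =
  node (Refreshed⇒Alike x a) (inj₁ refl) (Refreshed⇒Alike y b)

Splits⇒Duplicates : ∀ {P Q l m n i j} → Splits P Q l m n → i ≤ j →
  let D = Duplicates i (λ x → Singleton x Q) (λ y → Singleton y P) j in D l m × D l n
Splits⇒Duplicates {Q = Q} {l} (f , g) i≤j with count l Q ≟ 1
... | yes s = let s₁ , s₂ = g s in inj₂ (i≤j , s , s₁) , inj₂ (i≤j , s , s₂)
... | no ns = let e₁ , e₂ = f ns in inj₁ (sym e₁) , inj₁ (sym e₂)

singleton-≤ : ∀ {x m} T → m ≤ cnt x T → Singleton x T → m ≤ 1
singleton-≤ {x} T l s = ≤-trans l (≤-reflexive (trans (sym (count≡cnt x T)) s))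

branch-≤ : ∀ {x c k i X Y} Φ s →
  cnt x ((Φ ⟦ select s X Y ⟧) ⟨ c [ k ^ i ] ⟩ lit (pos 0)) ≤ cnt x (Φ ⟦ X ⟨ c [ k ^ i ] ⟩ Y ⟧)
branch-≤ {x} {c} {k} {i} {X} {Y} Φ left
  rewrite cnt-plug x Φ X | cnt-plug x Φ (X ⟨ c [ k ^ i ] ⟩ Y) =
  ≤-by (cnt x Y) (arith (cntᶜ x Φ) (cnt x X) (δ x k) (cnt x Y))
  where
  arith : ∀ f a d b → f + a + (d + 0) + b ≡ f + (a + (d + b))
  arith = solve-∀
branch-≤ {x} {c} {k} {i} {X} {Y} Φ right
  rewrite cnt-plug x Φ Y | cnt-plug x Φ (X ⟨ c [ k ^ i ] ⟩ Y) =
  ≤-by (cnt x X) (arith (cntᶜ x Φ) (cnt x X) (δ x k) (cnt x Y))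
  where
  arith : ∀ f a d b → f + b + (d + 0) + a ≡ f + (a + (d + b))
  arith = solve-∀

pick-distrib : ∀ s t {a b c d} → pick s (pick t a b) (pick t c d) ≡ pick t (pick s a c) (pick s b d)
pick-distrib left  t     = refl
pick-distrib right t     = refl

pick-idem : ∀ s {a} → pick s a a ≡ a
pick-idem left  = refl
pick-idem right = refl

-- If `κ` selects left, so does its inner occurrence, and `B` is never reached; if it selects right,
-- the whole left branch is ignored.
I-left-≋ : ∀ Φ Ψ {κ A B C} →
  Φ ⟦ (Ψ ⟦ A ⟧) ⟨ κ ⟩ C ⟧ ≋ Φ ⟦ (Ψ ⟦ A ⟨ κ ⟩ B ⟧) ⟨ κ ⟩ C ⟧
I-left-≋ Φ Ψ {κ} {A} {B} {C} = ≋-pointwise λ I F → eval-plug Φ (go I F)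
  where
  go : ∀ I F → eval I F ((Ψ ⟦ A ⟧) ⟨ κ ⟩ C) ≡ eval I F ((Ψ ⟦ A ⟨ κ ⟩ B ⟧) ⟨ κ ⟩ C)
  go I F with F (rank κ) (id κ) in e
  ... | left  = eval-plug Ψ (sym (pick-cong e refl refl))
  ... | right = refl

I-right-≋ : ∀ Φ Ψ {κ A B C} →
  Φ ⟦ C ⟨ κ ⟩ (Ψ ⟦ A ⟧) ⟧ ≋ Φ ⟦ C ⟨ κ ⟩ (Ψ ⟦ B ⟨ κ ⟩ A ⟧) ⟧
I-right-≋ Φ Ψ {κ} {A} {B} {C} = ≋-pointwise λ I F → eval-plug Φ (go I F)
  where
  go : ∀ I F → eval I F (C ⟨ κ ⟩ (Ψ ⟦ A ⟧)) ≡ eval I F (C ⟨ κ ⟩ (Ψ ⟦ B ⟨ κ ⟩ A ⟧))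
  go I F with F (rank κ) (id κ) in e
  ... | left  = refl
  ... | right = eval-plug Ψ (sym (pick-cong e refl refl))

-- The step is divided at the tree in which `l` and `C` are copied unchanged into both branches of
-- `k`. It evaluates like the conclusion, because selections commute and selecting between equal
-- values has no effect; it differs from the premise by a renaming within each branch.
II-left-≋ : ∀ Φ {⊙ ∘ k i l m n j A B C C₁ C₂} →
  let P = Φ ⟦ (A ⟨ ∘ [ m ^ j ] ⟩ C₁) ⟨ ⊙ [ k ^ i ] ⟩ (B ⟨ ∘ [ n ^ j ] ⟩ C₂) ⟧
      Q = Φ ⟦ (A ⟨ ⊙ [ k ^ i ] ⟩ B) ⟨ ∘ [ l ^ j ] ⟩ C ⟧
  in
  Splits P Q l m n → i ≤ j → Every (λ o → i ≤ rank o) C →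
  Refreshed P Q C C₁ → Refreshed P Q C C₂ → P ≋ Q
II-left-≋ Φ {⊙} {o} {k} {i} {l} {m} {n} {j} {A} {B} {C} {C₁} {C₂} sp i≤j ranks ref₁ ref₂ =
  ≋-trans (Every-plug Φ (λ { (node (node a x b) y c) → node (node a y c) x (node b y c) }) (λ h → h))
    (≋-sym (≋-duplicate Φ (λ x → Singleton x Q) (λ y → Singleton y P)
      -- A singleton of `Q` may occur twice in the intermediate tree, but at most once in either
      -- branch, which is what the matching of a branch requires.
      (λ { {x} left  → singleton-≤ Q (boundˡ x) ; {x} right → singleton-≤ Q (boundʳ x) })
      (λ s → singleton-≤ P (branch-≤ Φ s))
      (node (Alike-refl (inj₁ refl) A) (proj₁ d) (Refreshed⇒Alike ref₁ ranks))
      (node (Alike-refl (inj₁ refl) B) (proj₂ d) (Refreshed⇒Alike ref₂ ranks))))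
    (≋-pointwise λ I F → eval-plug Φ
      (trans (pick-distrib (F i k) (F j l)) (cong (pick (F j l) _) (pick-idem (F i k)))))
  where
  κ = ⊙ [ k ^ i ]
  λ′ = o [ l ^ j ]
  P = Φ ⟦ (A ⟨ o [ m ^ j ] ⟩ C₁) ⟨ κ ⟩ (B ⟨ o [ n ^ j ] ⟩ C₂) ⟧
  Q = Φ ⟦ (A ⟨ κ ⟩ B) ⟨ λ′ ⟩ C ⟧
  d = Splits⇒Duplicates {P} {Q} sp i≤j
  boundˡ : ∀ x → cnt x ((Φ ⟦ A ⟨ λ′ ⟩ C ⟧) ⟨ κ ⟩ lit (pos 0)) ≤ cnt x Q
  boundˡ x rewrite cnt-plug x Φ (A ⟨ λ′ ⟩ C) | cnt-plug x Φ ((A ⟨ κ ⟩ B) ⟨ λ′ ⟩ C) =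
    ≤-by (cnt x B) (arith (cntᶜ x Φ) (cnt x A) (cnt x B) (cnt x C) (δ x k) (δ x l))
    where
    arith : ∀ f a b c k l → f + (a + (l + c)) + (k + 0) + b ≡ f + (a + (k + b) + (l + c))
    arith = solve-∀
  boundʳ : ∀ x → cnt x ((Φ ⟦ B ⟨ λ′ ⟩ C ⟧) ⟨ κ ⟩ lit (pos 0)) ≤ cnt x Q
  boundʳ x rewrite cnt-plug x Φ (B ⟨ λ′ ⟩ C) | cnt-plug x Φ ((A ⟨ κ ⟩ B) ⟨ λ′ ⟩ C) =
    ≤-by (cnt x A) (arith (cntᶜ x Φ) (cnt x A) (cnt x B) (cnt x C) (δ x k) (δ x l))
    where
    arith : ∀ f a b c k l → f + (b + (l + c)) + (k + 0) + a ≡ f + (a + (k + b) + (l + c))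
    arith = solve-∀

II-right-≋ : ∀ Φ {⊙ ∘ k i l m n j A B C C₁ C₂} →
  let P = Φ ⟦ (C₁ ⟨ ∘ [ m ^ j ] ⟩ A) ⟨ ⊙ [ k ^ i ] ⟩ (C₂ ⟨ ∘ [ n ^ j ] ⟩ B) ⟧
      Q = Φ ⟦ C ⟨ ∘ [ l ^ j ] ⟩ (A ⟨ ⊙ [ k ^ i ] ⟩ B) ⟧
  in
  Splits P Q l m n → i ≤ j → Every (λ o → i ≤ rank o) C →
  Refreshed P Q C C₁ → Refreshed P Q C C₂ → P ≋ Q
II-right-≋ Φ {⊙} {o} {k} {i} {l} {m} {n} {j} {A} {B} {C} {C₁} {C₂} sp i≤j ranks ref₁ ref₂ =
  ≋-trans (Every-plug Φ (λ { (node c y (node a x b)) → node (node c y a) x (node c y b) }) (λ h → h))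
    (≋-sym (≋-duplicate Φ (λ x → Singleton x Q) (λ y → Singleton y P)
      (λ { {x} left  → singleton-≤ Q (boundˡ x) ; {x} right → singleton-≤ Q (boundʳ x) })
      (λ s → singleton-≤ P (branch-≤ Φ s))
      (node (Refreshed⇒Alike ref₁ ranks) (proj₁ d) (Alike-refl (inj₁ refl) A))
      (node (Refreshed⇒Alike ref₂ ranks) (proj₂ d) (Alike-refl (inj₁ refl) B))))
    (≋-pointwise λ I F → eval-plug Φ
      (trans (pick-distrib (F i k) (F j l)) (pick-cong {F j l} refl (pick-idem (F i k)) refl)))
  where
  κ = ⊙ [ k ^ i ]
  λ′ = o [ l ^ j ]
  P = Φ ⟦ (C₁ ⟨ o [ m ^ j ] ⟩ A) ⟨ κ ⟩ (C₂ ⟨ o [ n ^ j ] ⟩ B) ⟧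
  Q = Φ ⟦ C ⟨ λ′ ⟩ (A ⟨ κ ⟩ B) ⟧
  d = Splits⇒Duplicates {P} {Q} sp i≤j
  boundˡ : ∀ x → cnt x ((Φ ⟦ C ⟨ λ′ ⟩ A ⟧) ⟨ κ ⟩ lit (pos 0)) ≤ cnt x Q
  boundˡ x rewrite cnt-plug x Φ (C ⟨ λ′ ⟩ A) | cnt-plug x Φ (C ⟨ λ′ ⟩ (A ⟨ κ ⟩ B)) =
    ≤-by (cnt x B) (arith (cntᶜ x Φ) (cnt x A) (cnt x B) (cnt x C) (δ x k) (δ x l))
    where
    arith : ∀ f a b c k l → f + (c + (l + a)) + (k + 0) + b ≡ f + (c + (l + (a + (k + b))))
    arith = solve-∀
  boundʳ : ∀ x → cnt x ((Φ ⟦ C ⟨ λ′ ⟩ B ⟧) ⟨ κ ⟩ lit (pos 0)) ≤ cnt x Q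
  boundʳ x rewrite cnt-plug x Φ (C ⟨ λ′ ⟩ B) | cnt-plug x Φ (C ⟨ λ′ ⟩ (A ⟨ κ ⟩ B)) =
    ≤-by (cnt x A) (arith (cntᶜ x Φ) (cnt x A) (cnt x B) (cnt x C) (δ x k) (δ x l))
    where
    arith : ∀ f a b c k l → f + (c + (l + b)) + (k + 0) + a ≡ f + (c + (l + (a + (k + b))))
    arith = solve-∀

III-≋ : ∀ Φ {⊙ ∘ k i l m n j A B C D} →
  let P = Φ ⟦ (A ⟨ ∘ [ m ^ j ] ⟩ C) ⟨ ⊙ [ k ^ i ] ⟩ (B ⟨ ∘ [ n ^ j ] ⟩ D) ⟧
      Q = Φ ⟦ (A ⟨ ⊙ [ k ^ i ] ⟩ B) ⟨ ∘ [ l ^ j ] ⟩ (C ⟨ ⊙ [ k ^ i ] ⟩ D) ⟧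
  in
  Splits P Q l m n → i ≤ j → P ≋ Q
III-≋ Φ {⊙} {o} {k} {i} {l} {m} {n} {j} {A} {B} {C} {D} sp i≤j =
  ≋-trans (Every-plug Φ (λ { (node (node a x b) y (node c x′ d)) → node (node a y c) x (node b y d) }) (λ h → h))
    (≋-sym (≋-duplicate Φ (λ x → Singleton x Q) (λ y → Singleton y P)
      (λ { {x} left  → singleton-≤ Q (boundˡ x) ; {x} right → singleton-≤ Q (boundʳ x) })
      (λ s → singleton-≤ P (branch-≤ Φ s))
      (node (Alike-refl (inj₁ refl) A) (proj₁ dup) (Alike-refl (inj₁ refl) C))
      (node (Alike-refl (inj₁ refl) B) (proj₂ dup) (Alike-refl (inj₁ refl) D))))
    (≋-pointwise λ I F → eval-plug Φ (pick-distrib (F i k) (F j l)))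
  where
  κ = ⊙ [ k ^ i ]
  λ′ = o [ l ^ j ]
  P = Φ ⟦ (A ⟨ o [ m ^ j ] ⟩ C) ⟨ κ ⟩ (B ⟨ o [ n ^ j ] ⟩ D) ⟧
  Q = Φ ⟦ (A ⟨ κ ⟩ B) ⟨ λ′ ⟩ (C ⟨ κ ⟩ D) ⟧
  dup = Splits⇒Duplicates {P} {Q} sp i≤j
  boundˡ : ∀ x → cnt x ((Φ ⟦ A ⟨ λ′ ⟩ C ⟧) ⟨ κ ⟩ lit (pos 0)) ≤ cnt x Q
  boundˡ x rewrite cnt-plug x Φ (A ⟨ λ′ ⟩ C) | cnt-plug x Φ ((A ⟨ κ ⟩ B) ⟨ λ′ ⟩ (C ⟨ κ ⟩ D)) =
    ≤-by (cnt x B + (δ x k + cnt x D)) (arith (cntᶜ x Φ) (cnt x A) (cnt x B) (cnt x C) (cnt x D) (δ x k) (δ x l))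
    where
    arith : ∀ f a b c d k l → f + (a + (l + c)) + (k + 0) + (b + (k + d)) ≡
                              f + (a + (k + b) + (l + (c + (k + d))))
    arith = solve-∀
  boundʳ : ∀ x → cnt x ((Φ ⟦ B ⟨ λ′ ⟩ D ⟧) ⟨ κ ⟩ lit (pos 0)) ≤ cnt x Q
  boundʳ x rewrite cnt-plug x Φ (B ⟨ λ′ ⟩ D) | cnt-plug x Φ ((A ⟨ κ ⟩ B) ⟨ λ′ ⟩ (C ⟨ κ ⟩ D)) =
    ≤-by (cnt x A + (δ x k + cnt x C)) (arith (cntᶜ x Φ) (cnt x A) (cnt x B) (cnt x C) (cnt x D) (δ x k) (δ x l))
    where
    arith : ∀ f a b c d k l → f + (b + (l + d)) + (k + 0) + (a + (k + c)) ≡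
                              f + (a + (k + b) + (l + (c + (k + d))))
    arith = solve-∀

¬Occurs⇒Absent : ∀ {x T} → ¬ Occurs x T → Absent x T
¬Occurs⇒Absent {x} {T} h = All⇒Every T (¬Any⇒All¬ (oconnectives T) h)

-- Being its own inverse, a transposition serves as both directions of a translation.
transpose : ID → ID → ID → ID
transpose l r x = if does (x ≟ l) then r else if does (x ≟ r) then l else x

transpose-l : ∀ {l r x} → x ≡ l → transpose l r x ≡ r
transpose-l {l} {r} {x} e rewrite dec-true (x ≟ l) e = refl

transpose-r : ∀ {l r x} → l ≢ r → x ≡ r → transpose l r x ≡ l
transpose-r {l} {r} {x} ne refl rewrite dec-false (x ≟ l) (λ e → ne (sym e)) | dec-true (x ≟ x) refl = refl

transpose-other : ∀ {l r x} → x ≢ l → x ≢ r → transpose l r x ≡ x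
transpose-other {l} {r} {x} ne ne′ rewrite dec-false (x ≟ l) ne | dec-false (x ≟ r) ne′ = refl

substitute-Alike : ∀ {R : Rank → ID → ID → Set} {l j r B} →
  Every (λ o → (id o ≡ l → rank o ≡ j × R j l r) × (id o ≢ l → R (rank o) (id o) (id o))) B →
  Alike R B (B ⟪ l ^ j ↦ r ⟫)
substitute-Alike lit = lit
substitute-Alike {R} {l} {j} {r} (node {o = c [ k′ ^ i′ ]} a (f , g) b) =
  node (substitute-Alike a) (h (k′ ≟ l)) (substitute-Alike b)
  where
  h : Dec (k′ ≡ l) → R i′ k′ (if does (k′ ≟ l) Bool.∧ does (i′ ≟ j) then r else k′)
  h (yes refl) with f refl
  ... | refl , x rewrite dec-true (k′ ≟ k′) refl | dec-true (i′ ≟ i′) refl = x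
  h (no ne) rewrite dec-false (k′ ≟ l) ne = g ne

substitute-types : ∀ {p : Rank → Conn → Set} {l j r B} →
  Every (λ o → p (rank o) (conn o)) B → Every (λ o → p (rank o) (conn o)) (B ⟪ l ^ j ↦ r ⟫)
substitute-types lit          = lit
substitute-types (node a x b) = node (substitute-types a) x (substitute-types b)

cluster-ranks : ∀ {l j A} Q → Coherent Q → (∀ {o} → o ∈ oconnectives A → o ∈ oconnectives Q) →
  OccursIndex l j A → Every (λ o → id o ≡ l → rank o ≡ j) Q
cluster-ranks Q c A⊆Q occ with find occ
... | o , o∈ , refl , refl = Every-tabulate Q λ o′∈ e → Coherent.cluster-rank c o′∈ (A⊆Q o∈) e

-- After the selection left only `A` remains, where nothing is renamed. After the selection right
-- `A` is gone, so every remaining `l` is in `B`, and exchanging `l` with the fresh `r` is a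
-- translation. It concerns rank `j`, which is due after the selection at `k`.
IV-≋ : ∀ Φ {⊙ k i l r j A B} →
  let P = Φ ⟦ A ⟨ ⊙ [ k ^ i ] ⟩ (B ⟪ l ^ j ↦ r ⟫) ⟧
      Q = Φ ⟦ A ⟨ ⊙ [ k ^ i ] ⟩ B ⟧
  in
  Coherent Q → OccursIndex l j A → count l Q ≡ count l A + count l B → ¬ Occurs r Q → i < j → P ≋ Q
IV-≋ Φ {⊙} {k} {i} {l} {r} {j} {A} {B} coh occ only fresh i<j =
  ≋-sym (≋-translate Φ f f f-k f-k alike)
  where
  κ = ⊙ [ k ^ i ]
  Q = Φ ⟦ A ⟨ κ ⟩ B ⟧
  f : Side → ID → ID
  f left  x = x
  f right x = transpose l r x
  -- The equation between counts leaves no `l` in the context or at the displayed node; as `r` is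
  -- fresh, the transposition fixes both.
  only′ : cntᶜ l Φ + δ l k ≡ 0
  only′ = m+n≡0⇒n≡0 0 (+-cancelʳ-≡ (cnt l A + cnt l B) (cntᶜ l Φ + δ l k) 0 (begin
    cntᶜ l Φ + δ l k + (cnt l A + cnt l B)   ≡⟨ arith (cntᶜ l Φ) (δ l k) (cnt l A) (cnt l B) ⟩
    cntᶜ l Φ + (cnt l A + (δ l k + cnt l B)) ≡⟨ cnt-plug l Φ (A ⟨ κ ⟩ B) ⟨
    cnt l Q                                  ≡⟨ count≡cnt l Q ⟨
    count l Q                                ≡⟨ only ⟩
    count l A + count l B                    ≡⟨ cong₂ _+_ (count≡cnt l A) (count≡cnt l B) ⟩
    cnt l A + cnt l B                        ∎))
    where
    open ≡-Reasoning
    arith : ∀ f d a b → f + d + (a + b) ≡ f + (a + (d + b))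
    arith = solve-∀
  k≢l : k ≢ l
  k≢l e = case trans (sym (δ-≡ e)) (m+n≡0⇒n≡0 (cntᶜ l Φ) only′) of λ ()
  r-absent : Absent r Q
  r-absent = ¬Occurs⇒Absent {T = Q} fresh
  root-absent : Absent r (A ⟨ κ ⟩ B)
  root-absent = Every-subtree Φ r-absent
  k≢r : k ≢ r
  k≢r with node _ e _ ← root-absent = e
  B-absent : Absent r B
  B-absent with node _ _ b ← root-absent = b
  A⊆Q : ∀ {o} → o ∈ oconnectives A → o ∈ oconnectives Q
  A⊆Q with node a _ _ ← Every-subtree Φ (Every-∈ Q) = Every-lookup a
  ranks : Every (λ o → id o ≡ l → rank o ≡ j) B
  ranks with node _ _ b ← Every-subtree Φ (cluster-ranks {A = A} Q coh A⊆Q occ) = b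
  l≢r : l ≢ r
  l≢r e with find occ
  ... | o , o∈ , refl , _ with node a _ _ ← root-absent = Every-lookup a o∈ e
  f-k : ∀ s → f s k ≡ k
  f-k left  = refl
  f-k right = transpose-other k≢l k≢r
  fixed : ∀ {o} → id o ≢ l × id o ≢ r → Translates i (f right) (f right) (rank o) (id o) (id o)
  fixed (ne , ne′) = (λ _ → refl) , transpose-other ne ne′ , transpose-other ne ne′
  alike : ∀ s → Alike (Translates i (f s) (f s)) (Φ ⟦ select s A B ⟧) (Φ ⟦ select s A (B ⟪ l ^ j ↦ r ⟫) ⟧)
  alike left  = Alike-refl ((λ _ → refl) , refl , refl) _
  alike right = Alike-plug {L = pos 0} Φ
    (Every-map (λ {o} → fixed {o}) (Every-zip
      (absent-cnt (Φ ⟦ lit (pos 0) ⟧) (trans (cnt-plug l Φ (lit (pos 0)))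
        (trans (+-identityʳ _) (m+n≡0⇒m≡0 (cntᶜ l Φ) only′))))
      (Every-plug Φ (λ _ → lit) (λ h → h) r-absent)))
    (substitute-Alike (Every-map (λ {o} (e , ne) →
        (λ e′ → e e′ , (λ j<i → ⊥-elim (<-asym i<j j<i)) , transpose-l {l} refl , transpose-r l≢r refl)
      , (λ ne′ → fixed {o} (ne′ , ne)))
      (Every-zip ranks B-absent)))

-- Coherence enters through Rule IV: it puts all occurrences of `l` in rank `j`, so that replacing
-- the index renames every `l` in `B`.
⟶-≋ : ∀ {P Q} → P ⟶ Q → Coherent Q → P ≋ Q
⟶-≋ (I-left Φ Ψ)                      c = I-left-≋ Φ Ψ
⟶-≋ (I-right Φ Ψ)                     c = I-right-≋ Φ Ψ
⟶-≋ (II-left Φ {C = C} sp l r a b)    c = II-left-≋ Φ sp l (All⇒Every C r) a b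
⟶-≋ (II-right Φ {C = C} sp l r a b)   c = II-right-≋ Φ sp l (All⇒Every C r) a b
⟶-≋ (III Φ sp l)                      c = III-≋ Φ sp l
⟶-≋ (IV Φ o₁ o₂ only fresh l)         c = IV-≋ Φ c o₁ only fresh l

Refreshed-types : ∀ {p : Rank → Conn → Set} {P Q C C′} → Refreshed P Q C C′ →
  Every (λ o → p (rank o) (conn o)) C → Every (λ o → p (rank o) (conn o)) C′
Refreshed-types lit               lit          = lit
Refreshed-types (replace _ _ x y) (node a h b) = node (Refreshed-types x a) h (Refreshed-types y b)
Refreshed-types (keep _ x y)      (node a h b) = node (Refreshed-types x a) h (Refreshed-types y b)

-- Read upwards, rules change IDs but invent no new combination of rank and type. Types and rank
-- bound of the conclusion are therefore valid for the premise.
⟶-types : ∀ {p : Rank → Conn → Set} {P Q} → P ⟶ Q →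
  Every (λ o → p (rank o) (conn o)) Q → Every (λ o → p (rank o) (conn o)) P
⟶-types {p} (I-left Φ Ψ) = Every-plug Φ
  (λ { (node a x b) → node (Every-plug Ψ (λ { (node a _ _) → a }) (λ h → h) a) x b }) (λ h → h)
⟶-types {p} (I-right Φ Ψ) = Every-plug Φ
  (λ { (node a x b) → node a x (Every-plug Ψ (λ { (node _ _ b) → b }) (λ h → h) b) }) (λ h → h)
⟶-types {p} (II-left Φ sp l r x y) = Every-plug Φ (λ { (node (node a k b) h c) →
  node (node a h (Refreshed-types {p} x c)) k (node b h (Refreshed-types {p} y c)) }) (λ h → h)
⟶-types {p} (II-right Φ sp l r x y) = Every-plug Φ (λ { (node c h (node a k b)) →
  node (node (Refreshed-types {p} x c) h a) k (node (Refreshed-types {p} y c) h b) }) (λ h → h)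
⟶-types {p} (III Φ sp l) = Every-plug Φ (λ { (node (node a k b) h (node c k′ d)) →
  node (node a h c) k (node b h d) }) (λ h → h)
⟶-types {p} (IV Φ _ _ _ _ _) = Every-plug Φ (λ { (node a k b) →
  node a k (substitute-types {p} b) }) (λ h → h)

TrueUnder-step : ∀ {P Q I} → P ⊢ Q → (TrueUnder I (tree P) → TrueUnder I (tree Q)) ×
                                     (TrueUnder I (tree Q) → TrueUnder I (tree P))
TrueUnder-step {P} {Q} {I} st =
  (λ t → Winning⇒TrueUnder cQ I lQ (to eqv {q = q} rP rQ (TrueUnder⇒Winning cP I lP t))) ,
  (λ t → Winning⇒TrueUnder cP I lP (from eqv {q = q} rP rQ (TrueUnder⇒Winning cQ I lQ t)))
  where
  N  = rankBound (tree P) ⊔ rankBound (tree Q)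
  -- Types are read off the conclusion because every rank of the premise occurs there.
  q  = rankType (tree Q)
  lP = m≤m⊔n (rankBound (tree P)) (rankBound (tree Q))
  lQ = m≤n⊔m (rankBound (tree P)) (rankBound (tree Q))
  cQ : Compatible q N (tree Q)
  cQ = rankType-compatible (coherent Q) lQ
  cP : Compatible q N (tree P)
  cP = ⟶-types {λ r c → c ≡ q r × r < N} st cQ
  rP : Ranked N (tree P)
  rP = Every-map proj₂ cP
  rQ : Ranked N (tree Q)
  rQ = Every-map proj₂ cQ
  eqv = ⟶-≋ st (coherent Q)

Classical⇒cnt : ∀ {T} → Classical T → ∀ x → cnt x T ≤ 1
Classical⇒cnt {T} c x with Any.any? (λ o → id o ≟ x) (oconnectives T)
... | yes a = ≤-reflexive (trans (sym (count≡cnt x T)) (c x a))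
... | no na = ≤-trans (≤-reflexive (cnt-absent (¬Occurs⇒Absent {T = T} na))) z≤n

Occurs⇒cnt : ∀ {x} T → Occurs x T → 1 ≤ cnt x T
Occurs⇒cnt T occ with find occ
... | o , o∈ , refl = Every-lookup (Every-occurs T) o∈

cnt⇒Classical : ∀ {T} → (∀ x → cnt x T ≤ 1) → Classical T
cnt⇒Classical {T} u x occ = trans (count≡cnt x T) (≤-antisym (u x) (Occurs⇒cnt T occ))

classical-TrueUnder : ∀ C I → (∀ x → cnt x (tree C) ≤ 1) →
  (TrueUnder I (tree C) → ⟦ erase (tree C) ⟧ᶠ I ≡ true) ×
  (⟦ erase (tree C) ⟧ᶠ I ≡ true → TrueUnder I (tree C))
classical-TrueUnder C I u =
  (λ t → Winning⇒tautology I c u (TrueUnder⇒Winning c I ≤-refl t)) ,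
  (λ e → Winning⇒TrueUnder c I ≤-refl (tautology⇒Winning I c u e))
  where
  c : Compatible (rankType (tree C)) (rankBound (tree C)) (tree C)
  c = rankType-compatible (coherent C) ≤-refl

-- Reductions: derivations read upwards

Multiple : ID → Tree → Set
Multiple x T = 2 ≤ cnt x T

length≤1-unique : ∀ {x y : Oconnective} os → length os ≤ 1 → x ∈ os → y ∈ os → x ≡ y
length≤1-unique (_ ∷ [])     l (here refl) (here refl) = refl
length≤1-unique (_ ∷ _ ∷ _) (s≤s ()) _ _

cnt-unique : ∀ {o o′} T → cnt (id o) T ≤ 1 → o ∈ oconnectives T → o′ ∈ oconnectives T →
             id o ≡ id o′ → o ≡ o′
cnt-unique {o} T l o∈ o′∈ e = length≤1-unique _ (≤-trans (≤-reflexive (count≡cnt (id o) T)) l)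
  (∈-filter⁺ (λ z → id z ≟ id o) o∈ refl) (∈-filter⁺ (λ z → id z ≟ id o) o′∈ (sym e))

Preserves-types : (T′ T : Tree) → Set₁
Preserves-types T′ T = ∀ {p : Rank → Conn → Set} →
  Every (λ o → p (rank o) (conn o)) T → Every (λ o → p (rank o) (conn o)) T′

-- Read upwards, an inference taking Q to P, which replaces the subtree T by T′,
-- creates no new non-singleton clusters.
record Reduction (P Q T′ T : Tree) : Set₁ where
  field
    derive : (c : Coherent Q) → Σ (Coherent P) λ c′ →
             Star _⊢_ (record { tree = P ; coherent = c′ }) (record { tree = Q ; coherent = c })
    local  : ∀ {p} → Every p T → Every (λ o → Multiple (id o) P → p o) T′
    global : ∀ x → Multiple x P → Multiple x Q
    types  : Preserves-types T′ T

open Reduction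

-- The context stays visible, since whether a cluster is a singleton, and which IDs are fresh,
-- depends on the whole tree.
Reduces : Context → Tree → Tree → Set₁
Reduces Φ T′ T = Reduction (Φ ⟦ T′ ⟧) (Φ ⟦ T ⟧) T′ T

Reduces-refl : ∀ {Φ T} → Reduces Φ T T
Reduces-refl .derive c = c , ε
Reduces-refl .local    = Every-map (λ x _ → x)
Reduces-refl .global x m = m
Reduces-refl .types t = t

-- For `local`, the property handed through the middle tree is the one conditional on being multiple
-- in `Q`; `global` then supplies that condition from multiplicity in `P`.
Reduction-trans : ∀ {P Q R T″ T′ T} → Reduction P Q T″ T′ → Reduction Q R T′ T → Reduction P R T″ T
Reduction-trans a b .derive c =
  let c₁ , s₁ = derive b c ; c₂ , s₂ = derive a c₁ in c₂ , s₂ ◅◅ s₁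
Reduction-trans {P} {Q} a b .local {p} e =
  Every-map (λ {o} f m → f m (global a (id o) m)) (local a {λ o → Multiple (id o) Q → p o} (local b e))
Reduction-trans a b .global x m = global b x (global a x m)
Reduction-trans a b .types {p} t = types a {p} (types b {p} t)

_⊚_ : Context → Context → Context
hole          ⊚ Ψ = Ψ
leftOf Φ o B  ⊚ Ψ = leftOf (Φ ⊚ Ψ) o B
rightOf A o Φ ⊚ Ψ = rightOf A o (Φ ⊚ Ψ)

⊚-plug : ∀ Φ Ψ T → (Φ ⊚ Ψ) ⟦ T ⟧ ≡ Φ ⟦ Ψ ⟦ T ⟧ ⟧
⊚-plug hole            Ψ T = refl
⊚-plug (leftOf Φ o B)  Ψ T = cong (_⟨ o ⟩ B) (⊚-plug Φ Ψ T)
⊚-plug (rightOf A o Φ) Ψ T = cong (A ⟨ o ⟩_) (⊚-plug Φ Ψ T)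

inLeft : Context → Oconnective → Tree → Context
inLeft Φ o B = Φ ⊚ leftOf hole o B

inRight : Context → Tree → Oconnective → Context
inRight Φ A o = Φ ⊚ rightOf A o hole

Reduces-left : ∀ {Φ o B A′ A} → Reduces (inLeft Φ o B) A′ A → Reduces Φ (A′ ⟨ o ⟩ B) (A ⟨ o ⟩ B)
Reduces-left {Φ} {o} {B} {A′} {A} r
  rewrite ⊚-plug Φ (leftOf hole o B) A′ | ⊚-plug Φ (leftOf hole o B) A = record
  { derive = derive r
  ; local  = λ { (node a x b) → node (local r a) (λ _ → x) (Every-map (λ y _ → y) b) }
  ; global = global r
  ; types  = λ { {p} (node a x b) → node (types r {p} a) x b }
  }

Reduces-right : ∀ {Φ A o B′ B} → Reduces (inRight Φ A o) B′ B → Reduces Φ (A ⟨ o ⟩ B′) (A ⟨ o ⟩ B)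
Reduces-right {Φ} {A} {o} {B′} {B} r
  rewrite ⊚-plug Φ (rightOf A o hole) B′ | ⊚-plug Φ (rightOf A o hole) B = record
  { derive = derive r
  ; local  = λ { (node a x b) → node (Every-map (λ y _ → y) a) (λ _ → x) (local r b) }
  ; global = global r
  ; types  = λ { {p} (node a x b) → node a x (types r {p} b) }
  }

-- Two occurrences of one cluster of `P` either have equal oconnectives, the cluster occurring only
-- once, or belong to a multiple cluster and are then oconnectives of `Q`. Uniformity of ranks
-- follows because each pair of rank and type in `P` exists in `Q`.
step-coherent : ∀ {P Q} → (∀ {p} → Every p Q → Every (λ o → Multiple (id o) P → p o) P) →
  Preserves-types P Q → Coherent Q → Coherent P
step-coherent {P} {Q} loc typ c = record
  { cluster-conn = λ {o} {o′} o∈ o′∈ e → uniform conn (Coherent.cluster-conn c) o∈ o′∈ e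
  ; cluster-rank = λ {o} {o′} o∈ o′∈ e → uniform rank (Coherent.cluster-rank c) o∈ o′∈ e
  ; rank-conn    = λ o∈ o′∈ e →
      let q , q∈ , r , c₁ = Every-lookup origin o∈ ; q′ , q′∈ , r′ , c₁′ = Every-lookup origin o′∈
      in trans (sym c₁) (trans (Coherent.rank-conn c q∈ q′∈ (trans r (trans e (sym r′)))) c₁′)
  }
  where
  old : Every (λ o → Multiple (id o) P → o ∈ oconnectives Q) P
  old = loc (Every-∈ Q)
  uniform : ∀ {A : Set} (f : Oconnective → A) →
    (∀ {o o′} → o ∈ oconnectives Q → o′ ∈ oconnectives Q → id o ≡ id o′ → f o ≡ f o′) →
    ∀ {o o′} → o ∈ oconnectives P → o′ ∈ oconnectives P → id o ≡ id o′ → f o ≡ f o′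
  uniform f h {o} {o′} o∈ o′∈ e with 2 ≤? cnt (id o) P
  ... | yes m = h (Every-lookup old o∈ m)
                  (Every-lookup old o′∈ (subst (λ x → Multiple x P) e m)) e
  ... | no ¬m = cong f (cnt-unique P (≤-pred (≰⇒> ¬m)) o∈ o′∈ e)
  origin : Every (λ o → ∃[ q ] q ∈ oconnectives Q × rank q ≡ rank o × conn q ≡ conn o) P
  origin = typ {λ r k → ∃[ q ] q ∈ oconnectives Q × rank q ≡ r × conn q ≡ k}
    (Every-map (λ {o} o∈ → o , o∈ , refl , refl) (Every-∈ Q))

Reduces-step : ∀ Φ {T′ T} → Φ ⟦ T′ ⟧ ⟶ Φ ⟦ T ⟧ →
  (∀ {p} → Every p T → Every (λ o → Multiple (id o) (Φ ⟦ T′ ⟧) → p o) T′) →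
  (∀ x → Multiple x (Φ ⟦ T′ ⟧) → Multiple x (Φ ⟦ T ⟧)) →
  Preserves-types T′ T → Reduces Φ T′ T
Reduces-step Φ st loc glob typ = record
  { derive = λ c → step-coherent (Every-plug Φ loc (λ x _ → x)) (λ {p} → Every-plug Φ (typ {p}) (λ h → h)) c
                 , st ◅ ε
  ; local  = loc
  ; global = glob
  ; types  = λ {p} → typ {p}
  }

-- Copies of clusters and the upward use of Rules I to III

rename : (ID → ID) → Tree → Tree
rename ρ (lit L)               = lit L
rename ρ (A ⟨ c [ x ^ r ] ⟩ B) = rename ρ A ⟨ c [ ρ x ^ r ] ⟩ rename ρ B

rename-types : ∀ {ρ} T → Preserves-types (rename ρ T) T
rename-types (lit L)     {p} lit          = lit
rename-types (A ⟨ o ⟩ B) {p} (node a x b) = node (rename-types A {p} a) x (rename-types B {p} b)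

cnt-rename : ∀ {ρ x x′ T} → Every (λ o → (ρ (id o) ≡ x′ → id o ≡ x) × (id o ≡ x → ρ (id o) ≡ x′)) T →
             cnt x′ (rename ρ T) ≡ cnt x T
cnt-rename lit = refl
cnt-rename {ρ} {x} {x′} (node {o = o} a (f , g) b) =
  cong₂ _+_ (cnt-rename a) (cong₂ _+_ same (cnt-rename b))
  where
  same : δ x′ (ρ (id o)) ≡ δ x (id o)
  same with id o ≟ x
  ... | yes e = trans (δ-≡ (g e)) (sym (δ-≡ e))
  ... | no ne = trans (δ-≢ (λ e → ne (f e))) (sym (δ-≢ ne))

cnt-rename-0 : ∀ {ρ x T} → Every (λ o → ρ (id o) ≢ x) T → cnt x (rename ρ T) ≡ 0
cnt-rename-0 lit          = refl
cnt-rename-0 (node a e b) = cong₂ _+_ (cnt-rename-0 a) (cong₂ _+_ (δ-≢ e) (cnt-rename-0 b))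

rename-source : ∀ {ρ x} T → 1 ≤ cnt x (rename ρ T) → ∃[ y ] 1 ≤ cnt y T × ρ y ≡ x
rename-source {ρ} {x} T l with Any.any? (λ o → ρ (id o) ≟ x) (oconnectives T)
... | yes a = let o , o∈ , e = find a in id o , Every-lookup (Every-occurs T) o∈ , e
... | no na = ⊥-elim (<-irrefl (sym (cnt-rename-0 (All⇒Every T (¬Any⇒All¬ _ na)))) l)

bound : Tree → ℕ
bound (lit L)     = 0
bound (A ⟨ o ⟩ B) = bound A ⊔ (suc (id o) ⊔ bound B)

<bound : ∀ T → Every (λ o → id o < bound T) T
<bound (lit L)     = lit
<bound (A ⟨ o ⟩ B) = node
  (Every-map (λ l → ≤-trans l (m≤m⊔n (bound A) _)) (<bound A))
  (≤-trans (m≤m⊔n (suc (id o)) (bound B)) (m≤n⊔m (bound A) _))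
  (Every-map (λ l → ≤-trans l (≤-trans (m≤n⊔m (suc (id o)) (bound B)) (m≤n⊔m (bound A) _))) (<bound B))

bound-absent : ∀ {x} T → bound T ≤ x → Absent x T
bound-absent T l = Every-map (λ { l′ refl → <-irrefl refl (≤-trans l′ l) }) (<bound T)

cnt-bound : ∀ {x} T → 1 ≤ cnt x T → x < bound T
cnt-bound {x} T l with x <? bound T
... | yes x<  = x<
... | no x≮ = ⊥-elim (<-irrefl (sym (cnt-absent (bound-absent T (≮⇒≥ x≮)))) l)

-- Singletons are shifted beyond all IDs of `Q`, which makes their copies fresh and keeps them
-- distinct. Non-singletons keep their ID, as Rules II and III demand.
copyID : Tree → ID → ID
copyID Q x = if does (cnt x Q ≟ 1) then bound Q + x else x

copyID-once : ∀ {Q x} → Once x Q → copyID Q x ≡ bound Q + x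
copyID-once {Q} {x} e rewrite dec-true (cnt x Q ≟ 1) e = refl

copyID-other : ∀ {Q x} → ¬ Once x Q → copyID Q x ≡ x
copyID-other {Q} {x} e rewrite dec-false (cnt x Q ≟ 1) e = refl

-- A shifted ID is at least `bound Q`, so an ID that occurs in `Q` can only be the unshifted copy of
-- itself.
copyID-old : ∀ {x k} Q → 1 ≤ cnt k Q → copyID Q x ≡ k → x ≡ k
copyID-old {x} {k} Q l e with cnt x Q ≟ 1
... | yes o = ⊥-elim (<-irrefl refl (≤-trans (cnt-bound Q l)
                (subst (bound Q ≤_) (trans (sym (copyID-once {Q} o)) e) (m≤m+n (bound Q) x))))
... | no no′ = trans (sym (copyID-other {Q} no′)) e

copy-absent : ∀ {k} Q C → 1 ≤ cnt k Q → Absent k C → Absent k (rename (copyID Q) C)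
copy-absent Q (lit L)     l lit          = lit
copy-absent Q (A ⟨ o ⟩ B) l (node a e b) =
  node (copy-absent Q A l a) (λ e′ → e (copyID-old Q l e′)) (copy-absent Q B l b)

singleton⇒once : ∀ {x} T → Singleton x T → Once x T
singleton⇒once {x} T s = trans (sym (count≡cnt x T)) s

once⇒singleton : ∀ {x} T → Once x T → Singleton x T
once⇒singleton {x} T s = trans (count≡cnt x T) s

Within : Tree → Tree → Set
Within S = Every (λ o → 1 ≤ cnt (id o) S)

-- The inference duplicates the oconnectives of S, the copies being those of
-- rename (copyID Q) S.
module Copying (P Q S : Tree)
  (S≤Q : ∀ x → cnt x S ≤ cnt x Q)
  (S≤P : ∀ x → cnt x S ≤ cnt x P)
  (copy≤P : ∀ x → cnt x (rename (copyID Q) S) ≤ cnt x P)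
  (P≤ : ∀ x → cnt x P ≤ cnt x Q + cnt x (rename (copyID Q) S)) where

  ρ : ID → ID
  ρ = copyID Q

  M : ℕ
  M = bound Q

  S-bound : ∀ {y} → 1 ≤ cnt y S → y < M
  S-bound {y} l = cnt-bound Q (≤-trans l (S≤Q y))

  -- Only `x` itself could be copied to the old ID `x`, but as a singleton it is shifted away.
  once-copies : ∀ {x} → Once x Q → cnt x (rename ρ S) ≡ 0
  once-copies {x} o = cnt-rename-0 (Every-map (λ {o′} → avoid {o′}) (Every-occurs S))
    where
    avoid : ∀ {o′} → 1 ≤ cnt (id o′) S → ρ (id o′) ≢ x
    avoid {o′} l e = case copyID-old {id o′} Q (≤-reflexive (sym o)) e of λ
      { refl → <-irrefl refl (≤-trans (S-bound l) (≤-trans (m≤m+n M (id o′))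
                 (≤-reflexive (trans (sym (copyID-once {Q} o)) e)))) }

  fresh-copies : ∀ {s} → Once s Q → cnt (M + s) (rename ρ S) ≡ cnt s S
  fresh-copies {s} o = cnt-rename (Every-map (λ {o′} → both {o′}) (Every-occurs S))
    where
    both : ∀ {o′} → 1 ≤ cnt (id o′) S → (ρ (id o′) ≡ M + s → id o′ ≡ s) × (id o′ ≡ s → ρ (id o′) ≡ M + s)
    both {o′} l = to′ , λ { refl → copyID-once {Q} o }
      where
      to′ : ρ (id o′) ≡ M + s → id o′ ≡ s
      to′ e with cnt (id o′) Q ≟ 1
      ... | yes o₁ = +-cancelˡ-≡ M _ _ (trans (sym (copyID-once {Q} o₁)) e)
      ... | no no₁ = ⊥-elim (<-irrefl refl (≤-trans (S-bound l) (≤-trans (m≤m+n M s)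
                       (≤-reflexive (trans (sym e) (copyID-other {Q} no₁))))))

  source-once : ∀ {s} → Once s Q → 1 ≤ cnt s S → Once s P
  source-once {s} o l = ≤-antisym
    (≤-trans (P≤ s) (≤-reflexive (cong₂ _+_ o (once-copies o))))
    (≤-trans l (S≤P s))

  copy-once : ∀ {s} → Once s Q → 1 ≤ cnt s S → Once (M + s) P
  copy-once {s} o l = ≤-antisym
    (≤-trans (P≤ (M + s)) (≤-trans (≤-reflexive (cong₂ _+_
      (cnt-absent (bound-absent Q (m≤m+n M s))) (fresh-copies o)))
      (≤-trans (S≤Q s) (≤-reflexive o))))
    (≤-trans l (≤-trans (≤-reflexive (sym (fresh-copies o))) (copy≤P (M + s))))

  -- An ID that occurs once in `Q` gains no copy, and one that does not occur in `Q` can only be the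
  -- fresh copy of a singleton, which occurs once.
  multiple : ∀ x → Multiple x P → Multiple x Q
  multiple x m with cnt x Q in e
  ... | suc (suc n) = s≤s (s≤s z≤n)
  ... | suc zero = ⊥-elim (<-irrefl refl (≤-trans m (≤-trans (P≤ x)
                     (≤-reflexive (cong₂ _+_ e (once-copies e))))))
  ... | zero with rename-source S (≤-trans (s≤s z≤n) (≤-trans m (≤-trans (P≤ x)
                    (≤-reflexive (cong (_+ cnt x (rename ρ S)) e)))))
  ...   | y , l , refl with cnt y Q ≟ 1
  ...     | yes o = ⊥-elim (<-irrefl (sym (copy-once o l))
                      (subst (λ z → 2 ≤ cnt z P) (copyID-once {Q} o) m))
  ...     | no no′ = ⊥-elim (<-irrefl (sym (subst (λ z → cnt z Q ≡ 0) (copyID-other {Q} no′) e))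
                       (≤-trans l (S≤Q y)))

  copy-node : ∀ {p : Oconnective → Set} {c x r} → 1 ≤ cnt x S → p (c [ x ^ r ]) →
              Multiple (ρ x) P → p (c [ ρ x ^ r ])
  copy-node {p} {c} {x} {r} l h m with cnt x Q ≟ 1
  ... | yes o = ⊥-elim (<-irrefl (sym (copy-once o l)) (subst (λ z → 2 ≤ cnt z P) (copyID-once {Q} o) m))
  ... | no no′ = subst (λ z → p (c [ z ^ r ])) (sym (copyID-other {Q} no′)) h

  copy-local : ∀ {p C} → Within S C → Every p C → Every (λ o → Multiple (id o) P → p o) (rename ρ C)
  copy-local lit lit = lit
  copy-local {p} (node {o = o} a l b) (node a′ x b′) =
    node (copy-local a a′) (copy-node {p} {conn o} {id o} {rank o} l x) (copy-local b b′)

  source-refreshed : ∀ {C} → Within S C → Refreshed P Q C C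
  source-refreshed lit = lit
  source-refreshed (node {o = c [ x ^ r ]} a l b) with cnt x Q ≟ 1
  ... | yes o = replace (once⇒singleton Q o) (once⇒singleton P (source-once o l))
                  (source-refreshed a) (source-refreshed b)
  ... | no no′ = keep (λ s → no′ (singleton⇒once Q s)) (source-refreshed a) (source-refreshed b)

  copy-refreshed : ∀ {C} → Within S C → Refreshed P Q C (rename ρ C)
  copy-refreshed lit = lit
  copy-refreshed (node {A} {c [ x ^ r ]} {B} a l b) with cnt x Q ≟ 1
  ... | yes o = replace (once⇒singleton Q o)
                  (subst (λ z → Singleton z P) (sym (copyID-once {Q} o)) (once⇒singleton P (copy-once o l)))
                  (copy-refreshed a) (copy-refreshed b)
  ... | no no′ = subst (λ z → Refreshed P Q (A ⟨ c [ x ^ r ] ⟩ B) (rename ρ A ⟨ c [ z ^ r ] ⟩ rename ρ B))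
                   (sym (copyID-other {Q} no′))
                   (keep (λ s → no′ (singleton⇒once Q s)) (copy-refreshed a) (copy-refreshed b))

  copy-splits : ∀ {l} → 1 ≤ cnt l S → Splits P Q l l (ρ l)
  copy-splits {l} occurs =
    (λ ns → refl , copyID-other {Q} (λ o → ns (once⇒singleton Q o))) ,
    (λ s → let o = singleton⇒once Q s in
       once⇒singleton P (source-once o occurs) ,
       subst (λ z → Singleton z P) (sym (copyID-once {Q} o)) (once⇒singleton P (copy-once o occurs)))

AtLeast : Rank → Tree → Set
AtLeast i = Every (λ o → i ≤ rank o)

copy : Tree → Tree → Tree
copy Q = rename (copyID Q)

copyᵒ : Tree → Oconnective → Oconnective
copyᵒ Q (c [ x ^ r ]) = c [ copyID Q x ^ r ]

-- An empty inner context suffices, because repetitions are brought to the root of a branch before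
-- they are pruned.
I-left-Reduces : ∀ Φ {κ A B C} → Reduces Φ (A ⟨ κ ⟩ C) ((A ⟨ κ ⟩ B) ⟨ κ ⟩ C)
I-left-Reduces Φ {κ} {A} {B} {C} = Reduces-step Φ (I-left Φ hole)
  (λ { (node (node a _ _) k c) → node (Every-map (λ x _ → x) a) (λ _ → k) (Every-map (λ x _ → x) c) })
  (λ x m → ≤-trans m (smaller x))
  (λ { (node (node a _ _) k c) → node a k c })
  where
  smaller : ∀ x → cnt x (Φ ⟦ A ⟨ κ ⟩ C ⟧) ≤ cnt x (Φ ⟦ (A ⟨ κ ⟩ B) ⟨ κ ⟩ C ⟧)
  smaller x rewrite cnt-plug x Φ (A ⟨ κ ⟩ C) | cnt-plug x Φ ((A ⟨ κ ⟩ B) ⟨ κ ⟩ C) =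
    +-monoʳ-≤ (cntᶜ x Φ) (+-monoˡ-≤ _ (m≤m+n (cnt x A) _))

I-right-Reduces : ∀ Φ {κ A B C} → Reduces Φ (C ⟨ κ ⟩ A) (C ⟨ κ ⟩ (B ⟨ κ ⟩ A))
I-right-Reduces Φ {κ} {A} {B} {C} = Reduces-step Φ (I-right Φ hole)
  (λ { (node c k (node _ _ a)) → node (Every-map (λ x _ → x) c) (λ _ → k) (Every-map (λ x _ → x) a) })
  (λ x m → ≤-trans m (smaller x))
  (λ { (node c k (node _ _ a)) → node c k a })
  where
  smaller : ∀ x → cnt x (Φ ⟦ C ⟨ κ ⟩ A ⟧) ≤ cnt x (Φ ⟦ C ⟨ κ ⟩ (B ⟨ κ ⟩ A) ⟧)
  smaller x rewrite cnt-plug x Φ (C ⟨ κ ⟩ A) | cnt-plug x Φ (C ⟨ κ ⟩ (B ⟨ κ ⟩ A)) =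
    +-monoʳ-≤ (cntᶜ x Φ) (+-monoʳ-≤ (cnt x C) (+-monoʳ-≤ (δ x (id κ))
      (cnt-right {x} {B} {κ} {A})))

II-left-Reduces : ∀ Φ {κ o A B C} → rank κ ≤ rank o → AtLeast (rank κ) C →
  let Q = Φ ⟦ (A ⟨ κ ⟩ B) ⟨ o ⟩ C ⟧ in
  Reduces Φ ((A ⟨ o ⟩ C) ⟨ κ ⟩ (B ⟨ copyᵒ Q o ⟩ copy Q C)) ((A ⟨ κ ⟩ B) ⟨ o ⟩ C)
II-left-Reduces Φ {κ} {o} {A} {B} {C} i≤j ranks = Reduces-step Φ
  (II-left Φ (copy-splits (cnt-root {lit (pos 0)} {o} {C})) i≤j (Every⇒All ranks)
    (source-refreshed C⊆S) (copy-refreshed C⊆S))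
  (λ { {p} (node (node a k b) l c) →
    node (node (Every-map (λ x _ → x) a) (λ _ → l) (Every-map (λ x _ → x) c)) (λ _ → k)
         (node (Every-map (λ x _ → x) b)
               (copy-node {p} {conn o} {id o} {rank o} (cnt-root {lit (pos 0)} {o} {C}) l)
               (copy-local C⊆S c)) })
  multiple
  (λ { {p} (node (node a k b) l c) → node (node a l c) k (node b l (rename-types C {p} c)) })
  where
  Q = Φ ⟦ (A ⟨ κ ⟩ B) ⟨ o ⟩ C ⟧
  C′ = copy Q C
  T′ = (A ⟨ o ⟩ C) ⟨ κ ⟩ (B ⟨ copyᵒ Q o ⟩ C′)
  -- `S` gathers what is duplicated, namely `o` and the oconnectives of `C`; the literal merely
  -- completes the tree.
  S = lit (pos 0) ⟨ o ⟩ C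
  P≡ : ∀ x → cnt x Q + cnt x (copy Q S) ≡ cnt x (Φ ⟦ T′ ⟧)
  P≡ x rewrite cnt-plug x Φ T′ | cnt-plug x Φ ((A ⟨ κ ⟩ B) ⟨ o ⟩ C) =
    arith (cntᶜ x Φ) (cnt x A) (cnt x B) (cnt x C) (cnt x C′) (δ x (id κ)) (δ x (id o)) (δ x (copyID Q (id o)))
    where
    arith : ∀ f a b c c′ k l l′ →
      f + (a + (k + b) + (l + c)) + (l′ + c′) ≡ f + (a + (l + c) + (k + (b + (l′ + c′))))
    arith = solve-∀
  S≤Q : ∀ x → cnt x S ≤ cnt x Q
  S≤Q x rewrite cnt-plug x Φ ((A ⟨ κ ⟩ B) ⟨ o ⟩ C) =
    ≤-trans (m≤n+m _ (cnt x (A ⟨ κ ⟩ B))) (m≤n+m _ (cntᶜ x Φ))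
  open Copying (Φ ⟦ T′ ⟧) Q S S≤Q
    (λ x → ≤-trans (S≤Q x) (≤-by (cnt x (copy Q S)) (P≡ x)))
    (λ x → ≤-trans (m≤n+m _ (cnt x Q)) (≤-reflexive (P≡ x)))
    (λ x → ≤-reflexive (sym (P≡ x)))
  C⊆S : Within S C
  C⊆S with node _ _ c ← Every-occurs S = c

II-right-Reduces : ∀ Φ {κ o A B C} → rank κ ≤ rank o → AtLeast (rank κ) C →
  let Q = Φ ⟦ C ⟨ o ⟩ (A ⟨ κ ⟩ B) ⟧ in
  Reduces Φ ((C ⟨ o ⟩ A) ⟨ κ ⟩ (copy Q C ⟨ copyᵒ Q o ⟩ B)) (C ⟨ o ⟩ (A ⟨ κ ⟩ B))
II-right-Reduces Φ {κ} {o} {A} {B} {C} i≤j ranks = Reduces-step Φ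
  (II-right Φ (copy-splits o∈S) i≤j (Every⇒All ranks)
    (source-refreshed C⊆S) (copy-refreshed C⊆S))
  (λ { {p} (node c l (node a k b)) →
    node (node (Every-map (λ x _ → x) c) (λ _ → l) (Every-map (λ x _ → x) a)) (λ _ → k)
         (node (copy-local C⊆S c)
               (copy-node {p} {conn o} {id o} {rank o} o∈S l)
               (Every-map (λ x _ → x) b)) })
  multiple
  (λ { {p} (node c l (node a k b)) → node (node c l a) k (node (rename-types C {p} c) l b) })
  where
  Q = Φ ⟦ C ⟨ o ⟩ (A ⟨ κ ⟩ B) ⟧
  C′ = copy Q C
  T′ = (C ⟨ o ⟩ A) ⟨ κ ⟩ (C′ ⟨ copyᵒ Q o ⟩ B)
  S = C ⟨ o ⟩ lit (pos 0)
  o∈S = cnt-root {C} {o} {lit (pos 0)}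
  P≡ : ∀ x → cnt x Q + cnt x (copy Q S) ≡ cnt x (Φ ⟦ T′ ⟧)
  P≡ x rewrite cnt-plug x Φ T′ | cnt-plug x Φ (C ⟨ o ⟩ (A ⟨ κ ⟩ B)) =
    arith (cntᶜ x Φ) (cnt x A) (cnt x B) (cnt x C) (cnt x C′) (δ x (id κ)) (δ x (id o)) (δ x (copyID Q (id o)))
    where
    arith : ∀ f a b c c′ k l l′ →
      f + (c + (l + (a + (k + b)))) + (c′ + (l′ + 0)) ≡ f + (c + (l + a) + (k + (c′ + (l′ + b))))
    arith = solve-∀
  S≤Q : ∀ x → cnt x S ≤ cnt x Q
  S≤Q x rewrite cnt-plug x Φ (C ⟨ o ⟩ (A ⟨ κ ⟩ B)) =
    ≤-trans (+-monoʳ-≤ (cnt x C) (+-monoʳ-≤ (δ x (id o)) z≤n)) (m≤n+m _ (cntᶜ x Φ))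
  open Copying (Φ ⟦ T′ ⟧) Q S S≤Q
    (λ x → ≤-trans (S≤Q x) (≤-by (cnt x (copy Q S)) (P≡ x)))
    (λ x → ≤-trans (m≤n+m _ (cnt x Q)) (≤-reflexive (P≡ x)))
    (λ x → ≤-reflexive (sym (P≡ x)))
  C⊆S : Within S C
  C⊆S with node c _ _ ← Every-occurs S = c

III-Reduces : ∀ Φ {κ o A B C D} → rank κ ≤ rank o → id o ≢ id κ →
  let Q = Φ ⟦ (A ⟨ κ ⟩ B) ⟨ o ⟩ (C ⟨ κ ⟩ D) ⟧ in
  Reduces Φ ((A ⟨ o ⟩ C) ⟨ κ ⟩ (B ⟨ copyᵒ Q o ⟩ D)) ((A ⟨ κ ⟩ B) ⟨ o ⟩ (C ⟨ κ ⟩ D))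
III-Reduces Φ {κ} {o} {A} {B} {C} {D} i≤j o≢κ = Reduces-step Φ
  (III Φ (copy-splits o∈S) i≤j)
  (λ { {p} (node (node a k b) l (node c _ d)) →
    node (node (Every-map (λ x _ → x) a) (λ _ → l) (Every-map (λ x _ → x) c)) (λ _ → k)
         (node (Every-map (λ x _ → x) b)
               (copy-node {p} {conn o} {id o} {rank o} o∈S l)
               (Every-map (λ x _ → x) d)) })
  multiple
  (λ { {p} (node (node a k b) l (node c _ d)) → node (node a l c) k (node b l d) })
  where
  T = (A ⟨ κ ⟩ B) ⟨ o ⟩ (C ⟨ κ ⟩ D)
  Q = Φ ⟦ T ⟧
  T′ = (A ⟨ o ⟩ C) ⟨ κ ⟩ (B ⟨ copyᵒ Q o ⟩ D)
  S = lit (pos 0) ⟨ o ⟩ lit (pos 0)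
  o∈S = cnt-root {lit (pos 0)} {o} {lit (pos 0)}
  -- Besides duplicating `o`, the step merges two occurrences of `κ`, so the counts in the premise
  -- fall short by one at `id κ`.
  P≡ : ∀ x → cnt x (Φ ⟦ T′ ⟧) + δ x (id κ) ≡ cnt x Q + cnt x (copy Q S)
  P≡ x rewrite cnt-plug x Φ T′ | cnt-plug x Φ T =
    arith (cntᶜ x Φ) (cnt x A) (cnt x B) (cnt x C) (cnt x D) (δ x (id κ)) (δ x (id o)) (δ x (copyID Q (id o)))
    where
    arith : ∀ f a b c d k l l′ →
      f + (a + (l + c) + (k + (b + (l′ + d)))) + k ≡ f + (a + (k + b) + (l + (c + (k + d)))) + (l′ + 0)
    arith = solve-∀
  S≤Q : ∀ x → cnt x S ≤ cnt x Q
  S≤Q x rewrite cnt-plug x Φ T =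
    ≤-by (cntᶜ x Φ + cnt x (A ⟨ κ ⟩ B) + cnt x (C ⟨ κ ⟩ D))
      (arith (cntᶜ x Φ) (cnt x (A ⟨ κ ⟩ B)) (δ x (id o)) (cnt x (C ⟨ κ ⟩ D)))
    where
    arith : ∀ f a l c → l + 0 + (f + a + c) ≡ f + (a + (l + c))
    arith = solve-∀
  S≤P : ∀ x → cnt x S ≤ cnt x (Φ ⟦ T′ ⟧)
  S≤P x rewrite cnt-plug x Φ T′ =
    ≤-by (cntᶜ x Φ + cnt x A + cnt x C + (δ x (id κ) + cnt x (B ⟨ copyᵒ Q o ⟩ D)))
      (arith (cntᶜ x Φ) (cnt x A) (δ x (id o)) (cnt x C) (δ x (id κ) + cnt x (B ⟨ copyᵒ Q o ⟩ D)))
    where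
    arith : ∀ f a l c r → l + 0 + (f + a + c + r) ≡ f + (a + (l + c) + r)
    arith = solve-∀
  copy≤P : ∀ x → cnt x (copy Q S) ≤ cnt x (Φ ⟦ T′ ⟧)
  copy≤P x rewrite cnt-plug x Φ T′ =
    ≤-by (cntᶜ x Φ + cnt x (A ⟨ o ⟩ C) + δ x (id κ) + cnt x B + cnt x D)
      (arith (cntᶜ x Φ) (cnt x (A ⟨ o ⟩ C)) (δ x (id κ)) (cnt x B) (cnt x D) (δ x (copyID Q (id o))))
    where
    arith : ∀ f a k b d l → l + 0 + (f + a + k + b + d) ≡ f + (a + (k + (b + (l + d))))
    arith = solve-∀
  open Copying (Φ ⟦ T′ ⟧) Q S S≤Q S≤P copy≤P (λ x → ≤-by (δ x (id κ)) (P≡ x))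

-- Ordering ranks from the root downwards

data Heap : Tree → Set where
  lit  : ∀ {L} → Heap (lit L)
  node : ∀ {A o B} → Heap A → AtLeast (rank o) A → AtLeast (rank o) B → Heap B → Heap (A ⟨ o ⟩ B)

size : Tree → ℕ
size (lit L)     = 0
size (A ⟨ o ⟩ B) = suc (size A + size B)

size-rename : ∀ ρ T → size (rename ρ T) ≡ size T
size-rename ρ (lit L)     = refl
size-rename ρ (A ⟨ o ⟩ B) = cong suc (cong₂ _+_ (size-rename ρ A) (size-rename ρ B))

AtLeast-rename : ∀ {i} ρ {T} → AtLeast i T → AtLeast i (rename ρ T)
AtLeast-rename {i} ρ {T} = rename-types T {λ r _ → i ≤ r}

Heap-rename : ∀ ρ {T} → Heap T → Heap (rename ρ T)
Heap-rename ρ lit             = lit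
Heap-rename ρ (node a x y b) = node (Heap-rename ρ a) (AtLeast-rename ρ x) (AtLeast-rename ρ y) (Heap-rename ρ b)

AtLeast-weaken : ∀ {i j T} → i ≤ j → AtLeast j T → AtLeast i T
AtLeast-weaken l = Every-map (≤-trans l)

AtLeast-Reduces : ∀ {i P Q T′ T} → Reduction P Q T′ T → AtLeast i T → AtLeast i T′
AtLeast-Reduces {i} r = types r {λ j _ → i ≤ j}

root-least : ∀ {A o B} → Heap (A ⟨ o ⟩ B) → AtLeast (rank o) (A ⟨ o ⟩ B)
root-least (node _ x y _) = node x ≤-refl y

mutual
  -- If `o` does not have the least rank, a least root among the two heaps is floated above it by
  -- Rule II, whose condition on ranks holds because the other heap starts no lower. Rule II
  -- duplicates that other heap, so the tree may grow; but each recursive call combines one copy of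
  -- it with a single branch of the heap that lost its root, and the sum of the two sizes, bounded
  -- by `n`, drops.
  merge : ∀ n Φ A o C → size A + size C ≤ n → Heap A → Heap C →
          ∃[ T ] Reduces Φ T (A ⟨ o ⟩ C) × Heap T
  merge n Φ (lit L) o (lit M) s a c = _ , Reduces-refl {Φ} , node lit lit lit lit
  merge n Φ A@(A₁ ⟨ κ ⟩ A₂) o (lit M) s a c with rank o ≤? rank κ
  ... | yes l = _ , Reduces-refl {Φ} , node a (AtLeast-weaken l (root-least a)) lit c
  ... | no ¬l = float-left n Φ A₁ κ A₂ o (lit M) s a c (<⇒≤ (≰⇒> ¬l)) lit
  merge n Φ (lit L) o C@(C₁ ⟨ κ ⟩ C₂) s a c with rank o ≤? rank κ
  ... | yes l = _ , Reduces-refl {Φ} , node a lit (AtLeast-weaken l (root-least c)) c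
  ... | no ¬l = float-right n Φ (lit L) o C₁ κ C₂ s a c (<⇒≤ (≰⇒> ¬l)) lit
  merge n Φ A@(A₁ ⟨ α ⟩ A₂) o C@(C₁ ⟨ γ ⟩ C₂) s a c
    with rank o ≤? rank α | rank o ≤? rank γ | rank α ≤? rank γ
  ... | yes l | yes l′ | _ =
    _ , Reduces-refl {Φ} , node a (AtLeast-weaken l (root-least a)) (AtLeast-weaken l′ (root-least c)) c
  ... | no ¬l | _ | yes m =
    float-left n Φ A₁ α A₂ o C s a c (<⇒≤ (≰⇒> ¬l)) (AtLeast-weaken m (root-least c))
  ... | yes l | no ¬l | yes m = ⊥-elim (¬l (≤-trans l m))
  ... | _ | no ¬l | no ¬m =
    float-right n Φ A o C₁ γ C₂ s a c (<⇒≤ (≰⇒> ¬l)) (AtLeast-weaken (<⇒≤ (≰⇒> ¬m)) (root-least a))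
  ... | no ¬l | yes l | no ¬m = ⊥-elim (¬l (≤-trans l (<⇒≤ (≰⇒> ¬m))))

  float-left : ∀ n Φ A κ B o C → size (A ⟨ κ ⟩ B) + size C ≤ n → Heap (A ⟨ κ ⟩ B) → Heap C →
    rank κ ≤ rank o → AtLeast (rank κ) C → ∃[ T ] Reduces Φ T ((A ⟨ κ ⟩ B) ⟨ o ⟩ C) × Heap T
  float-left (suc n) Φ A κ B o C (s≤s s) (node ha a b hb) hc l c =
    let Q = Φ ⟦ (A ⟨ κ ⟩ B) ⟨ o ⟩ C ⟧
        C′ = copy Q C
        r₀ = II-left-Reduces Φ {κ} {o} {A} {B} {C} l c
        T₁ , r₁ , h₁ = merge n (inLeft Φ κ (B ⟨ copyᵒ Q o ⟩ C′)) A o C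
                         (≤-trans (+-monoˡ-≤ (size C) (m≤m+n (size A) (size B))) s) ha hc
        T₂ , r₂ , h₂ = merge n (inRight Φ T₁ κ) B (copyᵒ Q o) C′
                         (≤-trans (≤-reflexive (cong (size B +_) (size-rename (copyID Q) C)))
                           (≤-trans (+-monoˡ-≤ (size C) (m≤n+m (size B) (size A))) s))
                         hb (Heap-rename (copyID Q) hc)
    in T₁ ⟨ κ ⟩ T₂
     , Reduction-trans (Reduces-right {Φ} r₂) (Reduction-trans (Reduces-left {Φ} r₁) r₀)
     , node h₁ (AtLeast-Reduces r₁ (node a l c))
               (AtLeast-Reduces r₂ (node b l (AtLeast-rename (copyID Q) c))) h₂

  float-right : ∀ n Φ C o A κ B → size C + size (A ⟨ κ ⟩ B) ≤ n → Heap C → Heap (A ⟨ κ ⟩ B) →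
    rank κ ≤ rank o → AtLeast (rank κ) C → ∃[ T ] Reduces Φ T (C ⟨ o ⟩ (A ⟨ κ ⟩ B)) × Heap T
  float-right zero Φ C o A κ B s hc h l c =
    case trans (sym (+-suc (size C) (size A + size B))) (n≤0⇒n≡0 s) of λ ()
  float-right (suc n) Φ C o A κ B s hc (node ha a b hb) l c =
    let Q = Φ ⟦ C ⟨ o ⟩ (A ⟨ κ ⟩ B) ⟧
        C′ = copy Q C
        s′ = ≤-pred (≤-trans (≤-reflexive (sym (+-suc (size C) (size A + size B)))) s)
        r₀ = II-right-Reduces Φ {κ} {o} {A} {B} {C} l c
        T₁ , r₁ , h₁ = merge n (inLeft Φ κ (C′ ⟨ copyᵒ Q o ⟩ B)) C o A
                         (≤-trans (+-monoʳ-≤ (size C) (m≤m+n (size A) (size B))) s′) hc ha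
        T₂ , r₂ , h₂ = merge n (inRight Φ T₁ κ) C′ (copyᵒ Q o) B
                         (≤-trans (≤-reflexive (cong (_+ size B) (size-rename (copyID Q) C)))
                           (≤-trans (+-monoʳ-≤ (size C) (m≤n+m (size B) (size A))) s′))
                         (Heap-rename (copyID Q) hc) hb
    in T₁ ⟨ κ ⟩ T₂
     , Reduction-trans (Reduces-right {Φ} r₂) (Reduction-trans (Reduces-left {Φ} r₁) r₀)
     , node h₁ (AtLeast-Reduces r₁ (node c l a))
               (AtLeast-Reduces r₂ (node (AtLeast-rename (copyID Q) c) l b)) h₂

heapify : ∀ Φ T → ∃[ T′ ] Reduces Φ T′ T × Heap T′
heapify Φ (lit L)     = lit L , Reduces-refl {Φ} , lit
heapify Φ (A ⟨ o ⟩ B) =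
  let A′ , rA , hA = heapify (inLeft Φ o B) A
      B′ , rB , hB = heapify (inRight Φ A′ o) B
      T′ , r , h   = merge _ Φ A′ o B′ ≤-refl hA hB
  in T′ , Reduction-trans r (Reduction-trans (Reduces-right {Φ} rB) (Reduces-left {Φ} rA)) , h

-- Bringing a cluster to the root

-- What coherence says about one cluster, in a form inherited by subtrees.
OnlyAs : Oconnective → Tree → Set
OnlyAs κ = Every (λ o → id o ≡ id κ → o ≡ κ)

data Surfaced (Φ : Context) (κ : Oconnective) (T : Tree) : Set₁ where
  absent : Absent (id κ) T → Surfaced Φ κ T
  root   : ∀ X Y → Reduces Φ (X ⟨ κ ⟩ Y) T → Absent (id κ) X → Absent (id κ) Y → Surfaced Φ κ T

occurs-subtree : ∀ {x} Φ T → 1 ≤ cnt x T → 1 ≤ cnt x (Φ ⟦ T ⟧)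
occurs-subtree {x} Φ T l = ≤-trans l (≤-trans (m≤n+m _ (cntᶜ x Φ)) (≤-reflexive (sym (cnt-plug x Φ T))))

-- By induction `κ` occurs in each subtree at most at its root. If `o` is `κ`, those roots are
-- pruned. Otherwise `o` is exchanged with `κ`, by Rule II if one subtree contains `κ` and by Rule
-- III if both do, which leaves a single occurrence.
surface : ∀ Φ κ T → AtLeast (rank κ) T → OnlyAs κ T → Surfaced Φ κ T
surface Φ κ (lit L) ranks only = absent lit
surface Φ κ (A ⟨ o ⟩ B) (node ra ro rb) (node oa oo ob) with id o ≟ id κ
... | yes e with oo e
...   | refl = prune (surface (inLeft Φ κ B) κ A ra oa)
  where
  pruneʳ : ∀ A′ → Reduces Φ (A′ ⟨ κ ⟩ B) (A ⟨ κ ⟩ B) → Absent (id κ) A′ →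
           Surfaced (inRight Φ A′ κ) κ B → Surfaced Φ κ (A ⟨ κ ⟩ B)
  pruneʳ A′ r a (absent b)     = root A′ B r a b
  pruneʳ A′ r a (root X Y r′ x y) =
    root A′ Y (Reduction-trans (I-right-Reduces Φ) (Reduction-trans (Reduces-right {Φ} r′) r)) a y
  prune : Surfaced (inLeft Φ κ B) κ A → Surfaced Φ κ (A ⟨ κ ⟩ B)
  prune (absent a)     = pruneʳ A (Reduces-refl {Φ}) a (surface (inRight Φ A κ) κ B rb ob)
  prune (root X Y r x y) =
    pruneʳ X (Reduction-trans (I-left-Reduces Φ) (Reduces-left {Φ} r)) x (surface (inRight Φ X κ) κ B rb ob)
surface Φ κ (A ⟨ o ⟩ B) (node ra ro rb) (node oa oo ob) | no ne = exchange (surface (inLeft Φ o B) κ A ra oa)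
  where
  -- Since `κ` occurs in the conclusion, its ID is not that of a fresh copy, and copying a part free
  -- of `κ` brings in no new occurrence.
  κ-oldˡ : ∀ {X Y C} → 1 ≤ cnt (id κ) (Φ ⟦ (X ⟨ κ ⟩ Y) ⟨ o ⟩ C ⟧)
  κ-oldˡ {X} {Y} {C} = occurs-subtree Φ ((X ⟨ κ ⟩ Y) ⟨ o ⟩ C)
    (≤-trans (cnt-root {X} {κ} {Y}) (cnt-left {id κ} {X ⟨ κ ⟩ Y} {o} {C}))
  κ-oldʳ : ∀ {X Y C} → 1 ≤ cnt (id κ) (Φ ⟦ C ⟨ o ⟩ (X ⟨ κ ⟩ Y) ⟧)
  κ-oldʳ {X} {Y} {C} = occurs-subtree Φ (C ⟨ o ⟩ (X ⟨ κ ⟩ Y))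
    (≤-trans (cnt-root {X} {κ} {Y}) (cnt-right {id κ} {C} {o} {X ⟨ κ ⟩ Y}))
  exchangeˡ : ∀ {X Y} → Reduces (inLeft Φ o B) (X ⟨ κ ⟩ Y) A → Absent (id κ) X → Absent (id κ) Y →
              Surfaced (inRight Φ (X ⟨ κ ⟩ Y) o) κ B → Surfaced Φ κ (A ⟨ o ⟩ B)
  exchangeˡ {X} {Y} r x y (absent b) =
    root _ _ (Reduction-trans (II-left-Reduces Φ {κ} {o} {X} {Y} {B} ro rb) (Reduces-left {Φ} r))
      (node x ne b)
      (node y (λ e → ne (copyID-old Q κ-oldˡ e)) (copy-absent Q B κ-oldˡ b))
    where Q = Φ ⟦ (X ⟨ κ ⟩ Y) ⟨ o ⟩ B ⟧
  exchangeˡ {X} {Y} r x y (root Z W r′ z w) =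
    root _ _ (Reduction-trans (III-Reduces Φ {κ} {o} {X} {Y} {Z} {W} ro ne)
               (Reduction-trans (Reduces-right {Φ} r′) (Reduces-left {Φ} r)))
      (node x ne z)
      (node y (λ e → ne (copyID-old Q κ-oldˡ e)) w)
    where Q = Φ ⟦ (X ⟨ κ ⟩ Y) ⟨ o ⟩ (Z ⟨ κ ⟩ W) ⟧
  exchangeʳ : Absent (id κ) A → Surfaced (inRight Φ A o) κ B → Surfaced Φ κ (A ⟨ o ⟩ B)
  exchangeʳ a (absent b) = absent (node a ne b)
  exchangeʳ a (root X Y r x y) =
    root _ _ (Reduction-trans (II-right-Reduces Φ {κ} {o} {X} {Y} {A} ro ra) (Reduces-right {Φ} r))
      (node a ne x)
      (node (copy-absent Q A κ-oldʳ a) (λ e → ne (copyID-old Q κ-oldʳ e)) y)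
    where Q = Φ ⟦ A ⟨ o ⟩ (X ⟨ κ ⟩ Y) ⟧
  exchange : Surfaced (inLeft Φ o B) κ A → Surfaced Φ κ (A ⟨ o ⟩ B)
  exchange (absent a)       = exchangeʳ a (surface (inRight Φ A o) κ B rb ob)
  exchange (root X Y r x y) = exchangeˡ r x y (surface (inRight Φ (X ⟨ κ ⟩ Y) o) κ B rb ob)

-- Separating a cluster by Rule IV

substitute-every : ∀ {p l j r B} →
  Every (λ o → (id o ≡ l → rank o ≡ j × p (conn o [ r ^ rank o ])) × (id o ≢ l → p o)) B →
  Every p (B ⟪ l ^ j ↦ r ⟫)
substitute-every lit = lit
substitute-every {p} {l} {j} {r} (node {o = c [ k′ ^ i′ ]} a (f , g) b) =
  node (substitute-every a) (h (k′ ≟ l)) (substitute-every b)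
  where
  h : Dec (k′ ≡ l) → p (c [ if does (k′ ≟ l) Bool.∧ does (i′ ≟ j) then r else k′ ^ i′ ])
  h (yes refl) with f refl
  ... | refl , x rewrite dec-true (k′ ≟ k′) refl | dec-true (i′ ≟ i′) refl = x
  h (no ne) rewrite dec-false (k′ ≟ l) ne = g ne

substitute-cnt : ∀ {l j r x} B → x ≢ r → cnt x (B ⟪ l ^ j ↦ r ⟫) ≤ cnt x B
substitute-cnt (lit L) ne = z≤n
substitute-cnt {l} {j} {r} {x} (A ⟨ c [ k′ ^ i′ ] ⟩ B) ne =
  +-mono-≤ (substitute-cnt A ne) (+-mono-≤ (h (does (k′ ≟ l) Bool.∧ does (i′ ≟ j))) (substitute-cnt B ne))
  where
  h : ∀ b → δ x (if b then r else k′) ≤ δ x k′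
  h true  = ≤-trans (≤-reflexive (δ-≢ (λ e → ne (sym e)))) z≤n
  h false = ≤-refl

substitute-size : ∀ {l j r} B → size (B ⟪ l ^ j ↦ r ⟫) ≡ size B
substitute-size (lit L)     = refl
substitute-size (A ⟨ o ⟩ B) = cong suc (cong₂ _+_ (substitute-size A) (substitute-size B))

substitute-Heap : ∀ {l j r B} → Heap B → Heap (B ⟪ l ^ j ↦ r ⟫)
substitute-Heap lit = lit
substitute-Heap (node {o = o} a x y b) =
  node (substitute-Heap a) (substitute-types {λ k _ → rank o ≤ k} x)
       (substitute-types {λ k _ → rank o ≤ k} y) (substitute-Heap b)

-- `π` sends each cluster of `P` into a cluster of `Q`; dividing clusters further cannot destroy
-- uniformity.
relabel-coherent : ∀ {P Q} (π : ID → ID) →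
  Every (λ o → conn o [ π (id o) ^ rank o ] ∈ oconnectives Q) P → Coherent Q → Coherent P
relabel-coherent π h c = record
  { cluster-conn = λ a b e → Coherent.cluster-conn c (Every-lookup h a) (Every-lookup h b) (cong π e)
  ; cluster-rank = λ a b e → Coherent.cluster-rank c (Every-lookup h a) (Every-lookup h b) (cong π e)
  ; rank-conn    = λ a b e → Coherent.rank-conn c (Every-lookup h a) (Every-lookup h b) e
  }

cnt⇒∈ : ∀ {x} T → 1 ≤ cnt x T → ∃[ o ] o ∈ oconnectives T × id o ≡ x
cnt⇒∈ {x} T l with Any.any? (λ o → id o ≟ x) (oconnectives T)
... | yes a = find a
... | no na = ⊥-elim (<-irrefl (sym (cnt-absent (¬Occurs⇒Absent {T = T} na))) l)

only⇒OccursIndex : ∀ {κ} T → OnlyAs κ T → 1 ≤ cnt (id κ) T → OccursIndex (id κ) (rank κ) T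
only⇒OccursIndex T only l with cnt⇒∈ T l
... | o , o∈ , e with Every-lookup only o∈ e
...   | refl = lose o∈ (refl , refl)

absent⇒¬Occurs : ∀ {x T} → Absent x T → ¬ Occurs x T
absent⇒¬Occurs a = All¬⇒¬Any (Every⇒All a)

-- One application of Rule IV upwards, renaming the occurrences of κ in B.
module Separate (Φ : Context) (A : Tree) (o : Oconnective) (B : Tree) (κ : Oconnective)
  (o<κ : rank o < rank κ) (onlyA : OnlyAs κ A) (onlyB : OnlyAs κ B) (o≢κ : id o ≢ id κ)
  (outside : cntᶜ (id κ) Φ ≡ 0)
  (inA : 1 ≤ cnt (id κ) A) (inB : 1 ≤ cnt (id κ) B) where

  Q : Tree
  Q = Φ ⟦ A ⟨ o ⟩ B ⟧

  r : ID
  r = bound Q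

  κ′ : Oconnective
  κ′ = conn κ [ r ^ rank κ ]

  B′ : Tree
  B′ = B ⟪ id κ ^ rank κ ↦ r ⟫

  P : Tree
  P = Φ ⟦ A ⟨ o ⟩ B′ ⟧

  r-absent : Absent r Q
  r-absent = bound-absent Q ≤-refl

  r-absentᵗ : Absent r (A ⟨ o ⟩ B)
  r-absentᵗ = Every-subtree Φ r-absent

  r-absentA : Absent r A
  r-absentA with node a _ _ ← r-absentᵗ = a

  r-absentB : Absent r B
  r-absentB with node _ _ b ← r-absentᵗ = b

  o≢r : id o ≢ r
  o≢r with node _ e _ ← r-absentᵗ = e

  κ≢r : id κ ≢ r
  κ≢r e = <-irrefl (sym (cnt-absent (subst (λ x → Absent x A) (sym e) r-absentA))) inA

  only : count (id κ) Q ≡ count (id κ) A + count (id κ) B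
  only = begin
    count k Q                          ≡⟨ count≡cnt k Q ⟩
    cnt k Q                            ≡⟨ cnt-plug k Φ (A ⟨ o ⟩ B) ⟩
    cntᶜ k Φ + (cnt k A + (δ k (id o) + cnt k B))
      ≡⟨ cong₂ (λ x y → x + (cnt k A + (y + cnt k B))) outside (δ-≢ o≢κ) ⟩
    cnt k A + cnt k B                  ≡⟨ cong₂ _+_ (count≡cnt k A) (count≡cnt k B) ⟨
    count k A + count k B              ∎
    where
    open ≡-Reasoning
    k = id κ

  step : P ⟶ Q
  step = IV Φ (only⇒OccursIndex A onlyA inA) (only⇒OccursIndex B onlyB inB) only
           (absent⇒¬Occurs r-absent) o<κ

  π : ID → ID
  π x = if does (x ≟ r) then id κ else x

  π-r : π r ≡ id κ
  π-r rewrite dec-true (r ≟ r) refl = refl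

  π-other : ∀ {x} → x ≢ r → π x ≡ x
  π-other {x} ne rewrite dec-false (x ≟ r) ne = refl

  coherentP : Coherent Q → Coherent P
  coherentP = relabel-coherent π
    (Every-plug Φ
      (λ { (node a x b) → node (Every-map unchanged a) (unchanged x)
             (substitute-every (Every-map (λ {o′} (only , h) →
                 (λ e → cong rank (only e) , subst (λ z → conn o′ [ z ^ rank o′ ] ∈ oconnectives Q)
                          (trans e (sym π-r)) (proj₁ h))
               , (λ _ → unchanged h)) (Every-zip onlyB b))) })
      unchanged (Every-zip (Every-∈ Q) r-absent))
    where
    unchanged : ∀ {o′} → o′ ∈ oconnectives Q × id o′ ≢ r →
                conn o′ [ π (id o′) ^ rank o′ ] ∈ oconnectives Q
    unchanged {o′} (m , ne) = subst (λ z → conn o′ [ z ^ rank o′ ] ∈ oconnectives Q) (sym (π-other ne)) m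

  absentB′ : Absent (id κ) B′
  absentB′ = substitute-every (Every-map (λ onlyκ →
    (λ e → cong rank (onlyκ e) , (λ e′ → κ≢r (sym e′))) , (λ ne → ne)) onlyB)

  onlyB′ : OnlyAs κ′ B′
  onlyB′ = substitute-every (Every-map (λ (onlyκ , ne) →
    (λ e → cong rank (onlyκ e) , (λ _ → cong₂ (λ c j → c [ r ^ j ]) (cong conn (onlyκ e)) (cong rank (onlyκ e))))
    , (λ _ e → ⊥-elim (ne e))) (Every-zip onlyB r-absentB))

  local-B′ : ∀ {p} → Every p B → Every (λ o′ → id o′ ≢ r → p o′) B′
  local-B′ b = substitute-every (Every-map (λ (onlyκ , x) →
    (λ e → cong rank (onlyκ e) , (λ ne → ⊥-elim (ne refl))) , (λ _ _ → x)) (Every-zip onlyB b))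

  global-P : ∀ x → x ≢ r → Multiple x P → Multiple x Q
  global-P x ne m = ≤-trans m le
    where
    le : cnt x P ≤ cnt x Q
    le rewrite cnt-plug x Φ (A ⟨ o ⟩ B′) | cnt-plug x Φ (A ⟨ o ⟩ B) =
      +-monoʳ-≤ (cntᶜ x Φ) (+-monoʳ-≤ (cnt x A) (+-monoʳ-≤ (δ x (id o)) (substitute-cnt B ne)))

cntᶜ-⊚ : ∀ x Φ Ψ → cntᶜ x (Φ ⊚ Ψ) ≡ cntᶜ x Φ + cntᶜ x Ψ
cntᶜ-⊚ x Φ Ψ = begin
  cntᶜ x (Φ ⊚ Ψ)                     ≡⟨ +-identityʳ _ ⟨
  cntᶜ x (Φ ⊚ Ψ) + 0                 ≡⟨ cnt-plug x (Φ ⊚ Ψ) (lit (pos 0)) ⟨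
  cnt x ((Φ ⊚ Ψ) ⟦ lit (pos 0) ⟧)    ≡⟨ cong (cnt x) (⊚-plug Φ Ψ (lit (pos 0))) ⟩
  cnt x (Φ ⟦ Ψ ⟦ lit (pos 0) ⟧ ⟧)    ≡⟨ cnt-plug x Φ (Ψ ⟦ lit (pos 0) ⟧) ⟩
  cntᶜ x Φ + cnt x (Ψ ⟦ lit (pos 0) ⟧) ≡⟨ cong (cntᶜ x Φ +_) (cnt-plug x Ψ (lit (pos 0))) ⟩
  cntᶜ x Φ + (cntᶜ x Ψ + 0)          ≡⟨ cong (cntᶜ x Φ +_) (+-identityʳ _) ⟩
  cntᶜ x Φ + cntᶜ x Ψ                ∎
  where open ≡-Reasoning

outside-left : ∀ {x} Φ {o B} → cntᶜ x Φ ≡ 0 → id o ≢ x → Absent x B → cntᶜ x (inLeft Φ o B) ≡ 0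
outside-left {x} Φ {o} {B} e ne b =
  trans (cntᶜ-⊚ x Φ (leftOf hole o B)) (cong₂ _+_ e (cong₂ _+_ (δ-≢ ne) (cnt-absent b)))

outside-right : ∀ {x} Φ {o A} → cntᶜ x Φ ≡ 0 → Absent x A → id o ≢ x → cntᶜ x (inRight Φ A o) ≡ 0
outside-right {x} Φ {o} {A} e a ne =
  trans (cntᶜ-⊚ x Φ (rightOf A o hole)) (cong₂ _+_ e (cong₂ _+_ (cnt-absent a) (cong (_+ 0) (δ-≢ ne))))

-- The bound `n` replaces structural recursion, because after Rule IV the recursion enters `B′`,
-- which has the size of `B` but is no subtree of `T`. That `κ` does not occur outside the hole is
-- the side condition of Rule IV, and it is maintained on the way down: either one side is free of
-- `κ`, or Rule IV has just removed `κ` from the right side.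
separate : ∀ n Φ κ T → size T ≤ n → Heap T → OnlyAs κ T → cntᶜ (id κ) Φ ≡ 0 →
           ∃[ T′ ] Reduces Φ T′ T × ¬ Multiple (id κ) (Φ ⟦ T′ ⟧)
separate n Φ κ (lit L) s h only out = lit L , Reduces-refl {Φ} , λ m →
  case ≤-trans m (≤-reflexive (trans (cnt-plug (id κ) Φ (lit L)) (cong (_+ 0) out))) of λ ()
separate (suc n) Φ κ T@(A ⟨ o ⟩ B) (s≤s s) h@(node hA lA lB hB) only@(node oA oo oB) out with rank o <? rank κ
... | no o≮κ with surface Φ κ T (AtLeast-weaken (≮⇒≥ o≮κ) (root-least h)) only
...   | absent a = T , Reduces-refl {Φ} , λ m →
  case ≤-trans m (≤-reflexive (trans (cnt-plug (id κ) Φ T) (cong₂ _+_ out (cnt-absent a)))) of λ ()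
...   | root X Y r x y = X ⟨ κ ⟩ Y , r , λ m → <-irrefl refl (≤-trans m (≤-reflexive
  (trans (cnt-plug (id κ) Φ (X ⟨ κ ⟩ Y)) (cong₂ _+_ out
    (cong₂ _+_ (cnt-absent x) (cong₂ _+_ (δ-≡ {id κ} refl) (cnt-absent y)))))))
separate (suc n) Φ κ T@(A ⟨ o ⟩ B) (s≤s s) h@(node hA lA lB hB) only@(node oA oo oB) out | yes o<κ
  with absent? (id κ) A | absent? (id κ) B
... | _ | inj₁ b =
  let A′ , r , u = separate n (inLeft Φ o B) κ A (≤-trans (m≤m+n _ _) s) hA oA (outside-left Φ out o≢κ b)
  in A′ ⟨ o ⟩ B , Reduces-left {Φ} r , λ m → u (subst (Multiple (id κ)) (sym (⊚-plug Φ (leftOf hole o B) A′)) m)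
  where
  o≢κ : id o ≢ id κ
  o≢κ e = <-irrefl (cong rank (oo e)) o<κ
... | inj₁ a | inj₂ _ =
  let B′ , r , u = separate n (inRight Φ A o) κ B (≤-trans (m≤n+m _ _) s) hB oB (outside-right Φ out a o≢κ)
  in A ⟨ o ⟩ B′ , Reduces-right {Φ} r , λ m → u (subst (Multiple (id κ)) (sym (⊚-plug Φ (rightOf A o hole) B′)) m)
  where
  o≢κ : id o ≢ id κ
  o≢κ e = <-irrefl (cong rank (oo e)) o<κ
... | inj₂ inA | inj₂ inB = finish
  where
  o≢κ : id o ≢ id κ
  o≢κ e = <-irrefl (cong rank (oo e)) o<κ
  open Separate Φ A o B κ o<κ oA oB o≢κ out inA inB
  IHA = separate n (inLeft Φ o B′) κ A (≤-trans (m≤m+n _ _) s) hA oA (outside-left Φ out o≢κ absentB′)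
  A′ = proj₁ IHA
  r₁ : Reduces Φ (A′ ⟨ o ⟩ B′) (A ⟨ o ⟩ B′)
  r₁ = Reduces-left {Φ} (proj₁ (proj₂ IHA))
  u₁ : ¬ Multiple (id κ) (Φ ⟦ A′ ⟨ o ⟩ B′ ⟧)
  u₁ m = proj₂ (proj₂ IHA) (subst (Multiple (id κ)) (sym (⊚-plug Φ (leftOf hole o B′) A′)) m)
  -- Rule IV makes the new cluster r a non-singleton, so it is not itself a
  -- Reduction; it becomes one once r has been made a singleton as well.
  conclude : ∀ {T″} → Reduces Φ T″ (A′ ⟨ o ⟩ B′) → ¬ Multiple r (Φ ⟦ T″ ⟧) →
             ∃[ T′ ] Reduces Φ T′ T × ¬ Multiple (id κ) (Φ ⟦ T′ ⟧)
  conclude {T″} r₂ u₂ = T″ , record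
    { derive = λ c → let c₁ = coherentP c ; c₂ , st = derive r₁₂ c₁ in c₂ , st ◅◅ (step ◅ ε)
    ; local  = λ { {p} (node a x b) →
        Every-map (λ {o′} f m → f m (λ e → u₂ (subst (λ z → Multiple z (Φ ⟦ T″ ⟧)) e m)))
          (local r₁₂ {λ o′ → id o′ ≢ r → p o′}
            (node (Every-map (λ y _ → y) a) (λ _ → x) (local-B′ b))) }
    ; global = λ x m → global-P x (λ { refl → u₂ m }) (global r₁₂ x m)
    ; types  = λ { {p} (node a x b) → types r₁₂ {p} (node a x (substitute-types {p} b)) }
    } , λ m → u₁ (global r₂ (id κ) m)
    where
    r₁₂ : Reduces Φ T″ (A ⟨ o ⟩ B′)
    r₁₂ = Reduction-trans r₂ r₁
  finish : ∃[ T′ ] Reduces Φ T′ T × ¬ Multiple (id κ) (Φ ⟦ T′ ⟧)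
  -- If `r` is already no non-singleton, nothing is left to do. If it is one, `local` guarantees
  -- that the reduction of `A` has put no `r` into `A′`, so that `r` is confined to `B′` as the next
  -- call requires.
  finish with 2 ≤? cnt r (Φ ⟦ A′ ⟨ o ⟩ B′ ⟧)
  ... | no u = conclude (Reduces-refl {Φ}) u
  ... | yes m =
    let B″ , r₂ , u = separate n (inRight Φ A′ o) κ′ B′
          (≤-trans (≤-reflexive (substitute-size B)) (≤-trans (m≤n+m _ _) s))
          (substitute-Heap hB) onlyB′ (outside-right Φ r-outside r-absentA′ o≢r)
    in conclude (Reduces-right {Φ} r₂) (λ m′ → u (subst (Multiple r) (sym (⊚-plug Φ (rightOf A′ o hole) B″)) m′))
    where
    r-absentA′ : Absent r A′
    r-absentA′ = Every-map (λ { f refl → f (subst (Multiple r) (sym (⊚-plug Φ (leftOf hole o B′) A′)) m) refl })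
                   (local (proj₁ (proj₂ IHA)) r-absentA)
    r-outside : cntᶜ r Φ ≡ 0
    r-outside = m+n≡0⇒m≡0 (cntᶜ r Φ) (trans (sym (cnt-plug r Φ (A ⟨ o ⟩ B))) (cnt-absent r-absent))

-- Reaching a classical cirquent, and the theorem

coherent⇒OnlyAs : ∀ {T κ} → Coherent T → κ ∈ oconnectives T → OnlyAs κ T
coherent⇒OnlyAs {T} {c₀ [ k₀ ^ i₀ ]} c κ∈ = Every-tabulate T λ { {c₁ [ k₁ ^ i₁ ]} o∈ refl →
  cong₂ (λ z j → z [ k₁ ^ j ]) (Coherent.cluster-conn c o∈ κ∈ refl) (Coherent.cluster-rank c o∈ κ∈ refl) }

-- `ks` lists the IDs that may still be non-singletons. Reductions add none, so each treated ID can
-- be struck off for good.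
classify : ∀ ks C → (∀ x → Multiple x (tree C) → x ∈ ks) →
           ∃[ P ] Star _⊢_ P C × (∀ x → cnt x (tree P) ≤ 1)
classify [] C only = C , ε , λ x → ≤-pred (≰⇒> λ m → case only x m of λ ())
-- Order of ranks is not among the results of `separate`, so it is established afresh for every
-- cluster.
classify (k ∷ ks) C only with heapify hole (tree C)
... | T₁ , r₁ , h with derive r₁ (coherent C) | 2 ≤? cnt k T₁
...   | c₁ , st₁ | no u =
  let P , st , cl = classify ks (record { tree = T₁ ; coherent = c₁ }) (λ x m →
        case only x (global r₁ x m) of λ { (here refl) → ⊥-elim (u m) ; (there x∈) → x∈ })
  in P , st ◅◅ st₁ , cl
...   | c₁ , st₁ | yes m with cnt⇒∈ T₁ (≤-trans (s≤s z≤n) m)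
...     | κ , κ∈ , refl with separate _ hole κ T₁ ≤-refl h (coherent⇒OnlyAs c₁ κ∈) refl
...       | T₂ , r₂ , u with derive r₂ c₁
...         | c₂ , st₂ =
  let P , st , cl = classify ks (record { tree = T₂ ; coherent = c₂ }) (λ x m →
        case only x (global r₁ x (global r₂ x m)) of λ { (here refl) → ⊥-elim (u m) ; (there x∈) → x∈ })
  in P , st ◅◅ (st₂ ◅◅ st₁) , cl

TrueUnder-derivation : ∀ {P Q I} → Star _⊢_ P Q →
  (TrueUnder I (tree P) → TrueUnder I (tree Q)) × (TrueUnder I (tree Q) → TrueUnder I (tree P))
TrueUnder-derivation ε = (λ t → t) , (λ t → t)
TrueUnder-derivation {P} {Q} {I} (_◅_ {j = R} st sts) =
  let f , g = TrueUnder-step {P} {R} {I} st ; f′ , g′ = TrueUnder-derivation {I = I} sts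
  in (λ t → f′ (f t)) , (λ t → g (g′ t))

theorem3p3 : (C : Cirquent) → Valid C ⇔ Provable C
theorem3p3 C = mk⇔ complete sound
  where
  sound : Provable C → Valid C
  sound (A , (classical , taut) , st) I =
    proj₁ (TrueUnder-derivation {I = I} st)
      (proj₂ (classical-TrueUnder A I (Classical⇒cnt {tree A} classical)) (taut I))
  complete : Valid C → Provable C
  complete valid with classify (map id (oconnectives (tree C))) C
    (λ x m → case cnt⇒∈ (tree C) (≤-trans (s≤s z≤n) m) of λ { (o , o∈ , refl) → ∈-map⁺ id o∈ })
  ... | A , st , u = A ,
    (cnt⇒Classical {tree A} u , λ I → proj₁ (classical-TrueUnder A I u)
      (proj₂ (TrueUnder-derivation {I = I} st) (valid I))) , st
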